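{- Not every biconnected outer-$1$-plane graph of maximum degree $4$ admits an $\mathrm{OC}_2$-layout; that is, there exists a biconnected outer-$1$-plane graph of maximum degree $4$ that has no $\mathrm{OC}_2$-layout respecting its given embedding.
   Context: Graphs are finite and simple. A drawing maps vertices to distinct points of $\mathbb{R}^2$ and edges to curves joining the points of their endpoints; edges do not pass through other vertices, and edges with a common endpoint do not cross. A drawing is $1$-planar if each edge is crossed at most once, and outer-$1$-planar if in addition every vertex lies on the outer (unbounded) face. An outer-$1$-plane graph is a graph together with an outer-$1$-planar embedding, i.e. an outer-$1$-planar drawing in the plane considered up to its combinatorial structure: the cyclic order of the edges around each vertex, which edges cross and in which order, and the outer face. A layout of an outer-$1$-plane graph is always required to respect (realize) the given embedding. An orthogonal layout is a drawing in which each edge is drawn as a sequence of vertical and horizontal line segments, two consecutive segments of an edge meeting in a bend (a $90^\circ$ turn). Every vertex has four ports (North, South, East, West), each edge enters and leaves its end vertices at ports with a horizontal or vertical tangent, and no two edges incident to the same vertex use the same port. The curve complexity of a drawing is the maximum number of segments used for an edge. An $\mathrm{OC}_k$-layout is an orthogonal layout with curve complexity at most $k$, i.e. with at most $k-1$ bends per edge. "Maximum degree $4$" means every vertex has degree at most $4$. -}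

module Defs where

open import Algebra.Structures using (IsCommutativeRing)
open import Data.Fin.Base using (Fin)
open import Data.Fin.Properties using (_≟_)
open import Data.List.Base using (List; []; _∷_; _++_; length; filter; allFin; head; last)
open import Data.List.Membership.Propositional using (_∈_)
open import Data.List.Relation.Binary.Sublist.Propositional using (_⊆_)
open import Data.List.Relation.Unary.All using (All)
open import Data.List.Relation.Unary.Any using (Any)
open import Data.List.Relation.Unary.Linked using (Linked)
open import Data.List.Relation.Unary.Unique.Propositional using (Unique)
open import Data.Maybe.Base using (Maybe; just; fromMaybe)
open import Data.Nat.Base as ℕ using (ℕ)
open import Data.Product.Base using (Σ; ∃; ∃-syntax; _×_; _,_)
open import Data.Sum.Base using (_⊎_)
open import Data.Unit.Polymorphic.Base using (⊤)
open import Function.Bundles using (_⇔_)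
open import Level using (Level; _⊔_) renaming (suc to lsuc)
open import Relation.Binary.Construct.Closure.ReflexiveTransitive using (Star)
open import Relation.Binary.Core using (Rel)
open import Relation.Binary.PropositionalEquality using (_≡_; _≢_)
open import Relation.Binary.Structures using (IsStrictTotalOrder)
open import Relation.Nullary.Decidable.Core using (_⊎-dec_)
open import Relation.Nullary.Negation.Core using (¬_)
import Relation.Binary.Construct.StrictToNonStrict as StrictToNonStrict

------------------------------------------------------------------------
-- Coordinates

-- The library has no real numbers.  Everything geometric below is stated
-- over an arbitrary ordered field, ℝ being the intended one.
record OrderedField c ℓ : Set (lsuc (c ⊔ ℓ)) where
  infixl 7 _*_
  infixl 6 _+_ _-_
  infix  8 -_
  infix  4 _<_ _≤_
  field
    Carrier            : Set c
    _<_                : Rel Carrier ℓ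
    _+_ _*_            : Carrier → Carrier → Carrier
    -_                 : Carrier → Carrier
    0# 1#              : Carrier
    isCommutativeRing  : IsCommutativeRing _≡_ _+_ _*_ -_ 0# 1#
    inverse            : ∀ a → a ≢ 0# → ∃[ b ] a * b ≡ 1#
    isStrictTotalOrder : IsStrictTotalOrder _≡_ _<_
    0<1                : 0# < 1#
    +-monoʳ-<          : ∀ a {b d} → b < d → a + b < a + d
    *-pos              : ∀ {a b} → 0# < a → 0# < b → 0# < a * b

  _-_ : Carrier → Carrier → Carrier
  a - b = a + - b

  _≤_ : Rel Carrier (c ⊔ ℓ)
  _≤_ = StrictToNonStrict._≤_ _≡_ _<_

------------------------------------------------------------------------
-- Finite simple graphs

record Graph : Set where
  field
    n m     : ℕ
    src tgt : Fin m → Fin n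
    no-loop : ∀ e → src e ≢ tgt e
    simple  : ∀ e f →
              (src e ≡ src f × tgt e ≡ tgt f) ⊎ (src e ≡ tgt f × tgt e ≡ src f) →
              e ≡ f

  Vertex Edge : Set
  Vertex = Fin n
  Edge   = Fin m

  Incident : Vertex → Edge → Set
  Incident v e = v ≡ src e ⊎ v ≡ tgt e

  degree : Vertex → ℕ
  degree v = length (filter (λ e → (v ≟ src e) ⊎-dec (v ≟ tgt e)) (allFin m))

  -- src and tgt only name the two ends of an undirected edge; a dart is an
  -- edge together with the end (its tail) from which it is looked at.
  data Dart : Set where
    fwd bwd : Edge → Dart

  edge : Dart → Edge
  edge (fwd e) = e
  edge (bwd e) = e

  tail tip : Dart → Vertex
  tail (fwd e) = src e
  tail (bwd e) = tgt e
  tip  (fwd e) = tgt e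
  tip  (bwd e) = src e

  Adjacent : Rel Vertex _
  Adjacent u v = ∃[ d ] tail d ≡ u × tip d ≡ v

  Connected : Set
  Connected = ∀ u v → Star Adjacent u v

  ConnectedWithout : Vertex → Set
  ConnectedWithout w =
    ∀ u v → u ≢ w → v ≢ w → Star (λ s t → s ≢ w × t ≢ w × Adjacent s t) u v

  Biconnected : Set
  Biconnected = 3 ℕ.≤ n × Connected × (∀ w → ConnectedWithout w)

  MaxDegree≤ : ℕ → Set
  MaxDegree≤ k = ∀ v → degree v ℕ.≤ k

-- The combinatorial structure of an outer-1-planar drawing of G.
--
-- Since an edge has at most one crossing, the order of the crossings along
-- an edge carries no information and is not recorded.
--
-- The outer face is recorded by naming, for each vertex, a corner lying on
-- it: d stands for the corner at its tail immediately counterclockwise of d,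
-- i.e. to the left of d.  A vertex with two corners on the outer face is a
-- cut vertex, so for biconnected G these are all the corners of that face.
record Embedding (G : Graph) : Set where
  open Graph G
  field
    rotation        : Vertex → List Dart   -- counterclockwise, read cyclically
    rotation-unique : ∀ v → Unique (rotation v)
    rotation-darts  : ∀ v d → d ∈ rotation v ⇔ tail d ≡ v
    crossing        : Edge → Maybe Edge
    outer           : Vertex → Dart
    outer-tail      : ∀ v → tail (outer v) ≡ v

------------------------------------------------------------------------
-- Points, segments and polylines

module Plane {c ℓ} (K : OrderedField c ℓ) where
  open OrderedField K

  record Point : Set c where
    constructor ⟨_,_⟩
    field
      x y : Carrier
  open Point public

  infixl 6 _⊖_
  _⊖_ : Point → Point → Point
  p ⊖ q = ⟨ x p - x q , y p - y q ⟩

  det : Point → Point → Carrier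
  det u v = x u * y v - y u * x v

  -- u, v, w point in distinct directions that occur in this counterclockwise
  -- cyclic order: of the three angles from each to the next, summing to 2π,
  -- at least two are less than π.
  Counterclockwise : Point → Point → Point → Set ℓ
  Counterclockwise u v w =
    (0# < det u v × 0# < det v w) ⊎
    (0# < det v w × 0# < det w u) ⊎
    (0# < det w u × 0# < det u v)

  Segment : Set c
  Segment = Point × Point

  Between : Carrier → Carrier → Carrier → Set (c ⊔ ℓ)
  Between a b t = (a ≤ t × t ≤ b) ⊎ (b ≤ t × t ≤ a)

  infix 4 _on_ _inside_ _onPath_
  _on_ _inside_ : Point → Segment → Set (c ⊔ ℓ)
  r on (p , q) =
    det (q ⊖ p) (r ⊖ p) ≡ 0# × Between (x p) (x q) (x r) × Between (y p) (y q) (y r)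
  r inside (p , q) = r on (p , q) × r ≢ p × r ≢ q

  Horizontal Vertical AxisParallel : Segment → Set c
  Horizontal (p , q) = y p ≡ y q
  Vertical   (p , q) = x p ≡ x q
  AxisParallel s = Horizontal s ⊎ Vertical s

  Perpendicular : Rel Segment c
  Perpendicular s t = (Horizontal s × Vertical t) ⊎ (Vertical s × Horizontal t)

  -- s and t cross transversally at r, an interior point of both.
  CrossTransversally : Segment → Segment → Point → Set (c ⊔ ℓ)
  CrossTransversally s@(p , q) t@(p′ , q′) r =
    r inside s × r inside t × det (q ⊖ p) (q′ ⊖ p′) ≢ 0#

  segments : List Point → List Segment
  segments (p ∷ q ∷ ps) = (p , q) ∷ segments (q ∷ ps)
  segments _            = []

  _onPath_ : Point → List Point → Set (c ⊔ ℓ)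
  r onPath ps = Any (r on_) (segments ps)

  -- The polyline does not meet itself.
  SimplePath : List Point → Set (c ⊔ ℓ)
  SimplePath (p ∷ q ∷ ps) =
    p ≢ q ×
    (∀ r → r on (p , q) → r onPath (q ∷ ps) → r ≡ q) ×
    SimplePath (q ∷ ps)
  SimplePath _ = ⊤

  data Port : Set where
    north south east west : Port

  -- q is seen from p exactly in the direction of the port.
  Towards : Port → Rel Point (c ⊔ ℓ)
  Towards north p q = x p ≡ x q × y p < y q
  Towards south p q = x p ≡ x q × y q < y p
  Towards east  p q = x p < x q × y p ≡ y q
  Towards west  p q = x q < x p × y p ≡ y q

------------------------------------------------------------------------
-- Drawings

-- Edges are drawn as polylines, which realize every combinatorial structure
-- that arbitrary curves do.  Two edges may meet only at a common end or in a
-- transversal crossing; touching is not allowed.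
module _ {c ℓ} (K : OrderedField c ℓ) (G : Graph) where
  open OrderedField K
  open Plane K
  open Graph G

  record Drawing : Set (c ⊔ ℓ) where
    field
      pos   : Vertex → Point
      bends : Edge → List Point          -- from src to tgt, ends excluded

    path : Edge → List Point
    path e = pos (src e) ∷ bends e ++ pos (tgt e) ∷ []

    curve : Edge → List Segment
    curve e = segments (path e)

    -- e and f have r in common, and r is not a vertex.
    CrossAt : Edge → Edge → Point → Set (c ⊔ ℓ)
    CrossAt e f r =
      e ≢ f × r onPath path e × r onPath path f × (∀ v → r ≢ pos v)

    field
      pos-injective : ∀ {u v} → pos u ≡ pos v → u ≡ v
      path-simple   : ∀ e → SimplePath (path e)
      avoids        : ∀ e v → pos v onPath path e → Incident v e
      adjacent      : ∀ {e f v r} → Incident v e → Incident v f → ¬ CrossAt e f r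
      transversal   : ∀ {e f r} → CrossAt e f r →
                      ∃[ s ] ∃[ t ] s ∈ curve e × t ∈ curve f × CrossTransversally s t r

    -- The far end of the first segment of a dart.
    next : Dart → Point
    next (fwd e) = fromMaybe (pos (tgt e)) (head (bends e))
    next (bwd e) = fromMaybe (pos (src e)) (last (bends e))

    direction : Dart → Point
    direction d = next d ⊖ pos (tail d)

    Free : Point → Set (c ⊔ ℓ)
    Free r = (∀ v → r ≢ pos v) × (∀ e → ¬ (r onPath path e))

    -- Faces are the connected components of the complement of the drawing.
    -- That complement is open, so axis-parallel steps suffice to connect
    -- points of the same face.
    _⟶_ : Rel Point (c ⊔ ℓ)
    p ⟶ q = AxisParallel (p , q) × (∀ r → r on (p , q) → Free r)

    -- The points outside a box containing the drawing lie in one face, which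
    -- is therefore the one that has points arbitrarily far to the right.
    InOuterFace : Point → Set (c ⊔ ℓ)
    InOuterFace p = ∀ b → ∃[ q ] Star _⟶_ p q × b < x q

    -- The face to the left of d at its tail is the outer face: the point p of
    -- that face is reached from a point m of the first segment of d, before
    -- any crossing, by an axis-parallel step that leaves d to the left.
    OuterCorner : Dart → Set (c ⊔ ℓ)
    OuterCorner d = ∃[ m ] ∃[ p ]
      m inside (pos (tail d) , next d) ×
      (∀ f r → f ≢ edge d → r on (pos (tail d) , m) → r onPath path f → r ≡ pos (tail d)) ×
      AxisParallel (m , p) ×
      0# < det (direction d) (p ⊖ m) ×
      (∀ r → r on (m , p) → r ≡ m ⊎ Free r) ×
      InOuterFace p

  module _ (D : Drawing) where
    open Drawing D

    OnePlanar : Set (c ⊔ ℓ)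
    OnePlanar = ∀ e f g r s → CrossAt e f r → CrossAt e g s → f ≡ g × r ≡ s

    OuterOnePlanar : Set (c ⊔ ℓ)
    OuterOnePlanar = OnePlanar × (∀ v → ∃[ d ] tail d ≡ v × OuterCorner d)

    record Realizes (E : Embedding G) : Set (c ⊔ ℓ) where
      open Embedding E
      field
        rotations : ∀ v {d d′ d″} → d ∷ d′ ∷ d″ ∷ [] ⊆ rotation v →
                    Counterclockwise (direction d) (direction d′) (direction d″)
        crossings : ∀ e f → crossing e ≡ just f ⇔ (∃[ r ] CrossAt e f r)
        outerFace : ∀ v → OuterCorner (outer v)

    record Orthogonal : Set (c ⊔ ℓ) where
      field
        axisParallel : ∀ e → All AxisParallel (curve e)
        turns        : ∀ e → Linked Perpendicular (curve e)
        ports        : ∀ {d d′} π → tail d ≡ tail d′ →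
                       Towards π (pos (tail d)) (next d) →
                       Towards π (pos (tail d′)) (next d′) → d ≡ d′

    CurveComplexity≤ : ℕ → Set
    CurveComplexity≤ k = ∀ e → length (curve e) ℕ.≤ k

  -- With such an embedding E, the graph G is an outer-1-plane graph.
  IsOuterOnePlane : Embedding G → Set (c ⊔ ℓ)
  IsOuterOnePlane E = Σ Drawing λ D → OuterOnePlanar D × Realizes D E

  -- An OC_k-layout that respects the embedding E.
  OCLayout : ℕ → Embedding G → Set (c ⊔ ℓ)
  OCLayout k E = Σ Drawing λ D →
    OuterOnePlanar D × Realizes D E × Orthogonal D × CurveComplexity≤ D k

{-# OPTIONS --safe #-}

-- The graph consists of two copies abcd and a′b′c′d′ of K₄, each with crossing diagonals, joined by
-- two crossing edges aa′ and bb′.  In an OC₂-layout the crossing X of ac and bd and an edge such as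
-- ab bound a closed rectilinear polygon with at most six corners, a kite.  Its total turning is
-- ±360°: a closed hexagon of total turning 0 turns three times left and then three times right, and
-- crosses itself.  At a and b, of degree 4, all angles are right angles, and at c and d, of degree
-- 3, the kites have angles of at most 180°.  Comparing the bends of the half-edges around X through
-- the kites Xbc, Xcd and Xda, one finds from Xab that ab bends away from X.  In the kite formed by
-- ab and the crossing Y of aa′ and bb′ this bend is a reflex angle, which forces bb′ to bend between
-- b and Y.  By the same argument in the other copy, bb′ also bends between Y and b′.
--
-- That a straight-line drawing with integer coordinates realizes the embedding is decided over ℤ.

module Submission where

open import Defs
open import Algebra.Bundles using (CommutativeRing)
import Algebra.Properties.AbelianGroup
import Algebra.Properties.Group
import Algebra.Properties.Ring
import Algebra.Properties.Semiring.Mult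
import Algebra.Solver.Ring
open import Algebra.Solver.Ring.AlmostCommutativeRing using (fromCommutativeRing; _-Raw-AlmostCommutative⟶_)
open import Data.Empty using (⊥-elim)
open import Data.Fin.Base using (Fin; suc)
open import Data.Fin.Patterns
import Data.Fin.Properties as Fin
open import Data.Integer.Base as ℤ using (ℤ; -[1+_]; 0ℤ; 1ℤ; -1ℤ) renaming (+_ to nat)
import Data.Integer.Properties as ℤ
open import Data.List.Base using (List; []; _∷_; _++_; head; last; length)
import Data.List.Membership.DecPropositional as DecMembership
open import Data.List.Membership.Propositional using (_∈_; _∉_; find)
open import Data.List.Relation.Binary.Sublist.Propositional using (_⊆_; []; _∷_; _∷ʳ_; to∈)
open import Data.List.Relation.Unary.All as All using (All; []; _∷_)
open import Data.List.Relation.Unary.AllPairs as AllPairs using (AllPairs; []; _∷_)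
open import Data.List.Relation.Unary.Any using (Any; here; there; any?)
open import Data.List.Relation.Unary.Linked using (Linked; _∷_)
open import Data.List.Relation.Unary.Unique.Propositional using (Unique)
open import Data.Maybe.Base as Maybe using (Maybe; just; nothing; fromMaybe)
import Data.Maybe.Properties as Maybe
open import Data.Nat.Base as ℕ using (ℕ; zero; suc; z≤n; s≤s)
import Data.Nat.Properties as ℕ
open import Data.Product.Base using (Σ; ∃-syntax; _×_; _,_; proj₁; proj₂)
import Data.Product.Properties as Product
open import Data.Sum.Base using (_⊎_; inj₁; inj₂)
open import Data.Unit.Polymorphic.Base using (⊤; tt)
open import Data.Vec.Base using (Vec; []; _∷_; lookup)
open import Function.Base using (_∘_)
open import Function.Bundles using (Equivalence; mk⇔)
open import Level using (Level; _⊔_)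
open import Relation.Binary.Construct.Closure.ReflexiveTransitive as Star using (Star; _◅_) renaming (ε to stay)
open import Relation.Binary.Core using (Rel)
open import Relation.Binary.Definitions using (DecidableEquality; tri<; tri≈; tri>)
open import Relation.Binary.PropositionalEquality
open import Relation.Binary.Structures using (IsStrictTotalOrder)
open import Relation.Nullary.Decidable
  using (Dec; yes; no; dec⇒maybe; map′; _×-dec_; _→-dec_; _⊎-dec_; ¬?; from-yes)
open import Relation.Nullary.Negation.Core using (¬_; contradiction)
open import Relation.Unary using (Pred)

-- A single copy of K₄ forces `bb′` to bend only on its own side of Y, which an edge with two
-- segments can afford; the second copy demands another bend on the far side. The degrees make the
-- turn count rigid. Right angles at a and b turn the kite Xab into an equation between its three
-- bends. At c and d, an angle of 180° in place of 90° can shift the comparison of neighbouring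
-- half-edges in one direction only, so the inequalities from Xbc, Xcd and Xda chain up.
--
-- The obstacle is that the embedding records neither the sense in which a kite is traversed nor the
-- cyclic order of the half-edges at X. Hence the total turning is known only as +4 or -4 quarter
-- turns, and the turn `ε` at X, the same in all four kites around it, starts out as left or right.
-- Both ambiguities are resolved by arithmetic on turns: `ε ≡ right` makes Xab and Xbc incompatible,
-- and afterwards the bounds on the angles rule out -4.

module Field {c ℓ : Level} (K : OrderedField c ℓ) where
  open OrderedField K public
  open IsStrictTotalOrder isStrictTotalOrder public
    using (compare; _≟_; _<?_) renaming (trans to <-trans; irrefl to <-irrefl)

  commutativeRing : CommutativeRing c c
  commutativeRing = record { isCommutativeRing = isCommutativeRing }

  open CommutativeRing commutativeRing public
    using (+-identityˡ; +-identityʳ; +-comm; +-assoc; zeroʳ; -‿inverseʳ; *-identityˡ)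
  private
    module R = CommutativeRing commutativeRing
    module M = Algebra.Properties.Semiring.Mult R.semiring
  open Algebra.Properties.Ring R.ring using (-‿distribˡ-*; -‿distribʳ-*)
  open Algebra.Properties.AbelianGroup R.+-abelianGroup using (⁻¹-∙-comm)
  open Algebra.Properties.Group R.+-group using (ε⁻¹≈ε; ⁻¹-involutive)

  open ≡-Reasoning

  private
    ν : ℕ → Carrier
    ν n = n M.× 1#

  -- The ring homomorphism from the integers. It serves twice: it supplies the coefficients of the
  -- ring solver, and it carries facts decided over ℤ into the field.
  ι : ℤ → Carrier
  ι (nat n)  = ν n
  ι -[1+ n ] = - ν (suc n)

  private
    -- Proved by hand because the ring solver becomes available only once `ι` is known to be a
    -- homomorphism.
    shift : ∀ z a b → (z + a) - (z + b) ≡ a - b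
    shift z a b = begin
      (z + a) + - (z + b)     ≡⟨ cong (_+ - (z + b)) (+-comm z a) ⟩
      (a + z) + - (z + b)     ≡⟨ +-assoc a z _ ⟩
      a + (z + - (z + b))     ≡⟨ cong (λ w → a + (z + w)) (⁻¹-∙-comm z b) ⟨
      a + (z + (- z + - b))   ≡⟨ cong (a +_) (+-assoc z (- z) (- b)) ⟨
      a + (z + - z + - b)     ≡⟨ cong (λ w → a + (w + - b)) (-‿inverseʳ z) ⟩
      a + (0# + - b)          ≡⟨ cong (a +_) (+-identityˡ (- b)) ⟩
      a - b                   ∎

    ι-⊖ : ∀ m n → ι (m ℤ.⊖ n) ≡ ν m - ν n
    ι-⊖ m       zero    = sym (trans (cong (ν m +_) ε⁻¹≈ε) (+-identityʳ (ν m)))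
    ι-⊖ zero    (suc n) = sym (+-identityˡ _)
    ι-⊖ (suc m) (suc n) = begin
      ι (suc m ℤ.⊖ suc n)    ≡⟨ cong ι (ℤ.[1+m]⊖[1+n]≡m⊖n m n) ⟩
      ι (m ℤ.⊖ n)            ≡⟨ ι-⊖ m n ⟩
      ν m - ν n              ≡⟨ shift 1# (ν m) (ν n) ⟨
      ν (suc m) - ν (suc n)  ∎

    ι-neg : ∀ i → ι (ℤ.- i) ≡ - ι i
    ι-neg (nat zero)    = sym ε⁻¹≈ε
    ι-neg (nat (suc n)) = refl
    ι-neg -[1+ n ]      = sym (⁻¹-involutive _)

    ι-+ : ∀ i j → ι (i ℤ.+ j) ≡ ι i + ι j
    ι-+ (nat m)  (nat n)  = M.×-homo-+ 1# m n
    ι-+ (nat m)  -[1+ n ] = ι-⊖ m (suc n)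
    ι-+ -[1+ m ] (nat n)  = trans (ι-⊖ n (suc m)) (+-comm _ _)
    ι-+ -[1+ m ] -[1+ n ] = begin
      ι (-[1+ m ] ℤ.+ -[1+ n ])              ≡⟨ cong ι (ℤ.neg-distrib-+ (nat (suc m)) (nat (suc n))) ⟨
      ι (ℤ.- (nat (suc m) ℤ.+ nat (suc n)))  ≡⟨ ι-neg (nat (suc m) ℤ.+ nat (suc n)) ⟩
      - ν (suc m ℕ.+ suc n)                  ≡⟨ cong -_ (M.×-homo-+ 1# (suc m) (suc n)) ⟩
      - (ν (suc m) + ν (suc n))              ≡⟨ ⁻¹-∙-comm _ _ ⟨
      - ν (suc m) + - ν (suc n)              ∎

    ι-*⁺ : ∀ m j → ι (nat m ℤ.* j) ≡ ν m * ι j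
    ι-*⁺ m (nat n)  = trans (cong ι (sym (ℤ.pos-* m n))) (M.×1-homo-* m n)
    ι-*⁺ m -[1+ n ] = begin
      ι (nat m ℤ.* (ℤ.- (nat (suc n))))   ≡⟨ cong ι (ℤ.neg-distribʳ-* (nat m) (nat (suc n))) ⟨
      ι (ℤ.- (nat m ℤ.* nat (suc n)))     ≡⟨ ι-neg (nat m ℤ.* nat (suc n)) ⟩
      - ι (nat m ℤ.* nat (suc n))         ≡⟨ cong -_ (ι-*⁺ m (nat (suc n))) ⟩
      - (ν m * ν (suc n))                 ≡⟨ -‿distribʳ-* _ _ ⟩
      ν m * - ν (suc n)                   ∎

    ι-* : ∀ i j → ι (i ℤ.* j) ≡ ι i * ι j
    ι-* (nat m)  j = ι-*⁺ m j
    ι-* -[1+ m ] j = begin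
      ι ((ℤ.- (nat (suc m))) ℤ.* j)   ≡⟨ cong ι (ℤ.neg-distribˡ-* (nat (suc m)) j) ⟨
      ι (ℤ.- (nat (suc m) ℤ.* j))     ≡⟨ ι-neg (nat (suc m) ℤ.* j) ⟩
      - ι (nat (suc m) ℤ.* j)         ≡⟨ cong -_ (ι-*⁺ (suc m) j) ⟩
      - (ν (suc m) * ι j)             ≡⟨ -‿distribˡ-* _ _ ⟩
      - ν (suc m) * ι j               ∎

    ι-morphism : CommutativeRing.rawRing ℤ.+-*-commutativeRing
                   -Raw-AlmostCommutative⟶ fromCommutativeRing commutativeRing
    ι-morphism = record
      { ⟦_⟧ = ι ; +-homo = ι-+ ; *-homo = ι-* ; -‿homo = ι-neg
      ; 0-homo = refl ; 1-homo = +-identityʳ 1# }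

  open Algebra.Solver.Ring
    (CommutativeRing.rawRing ℤ.+-*-commutativeRing)
    (fromCommutativeRing commutativeRing) ι-morphism
    (λ i j → Maybe.map (cong ι) (dec⇒maybe (i ℤ.≟ j))) public
    using (solve; con; _:+_; _:*_; _:-_; :-_; _:=_)

  <-respʳ : ∀ {a b d} → a < b → b ≡ d → a < d
  <-respʳ p refl = p

  <-respˡ : ∀ {a b d} → b < a → b ≡ d → d < a
  <-respˡ p refl = p

  <⇒≢ : ∀ {a b} → a < b → a ≢ b
  <⇒≢ a<b a≡b = <-irrefl a≡b a<b

  <-asym : ∀ {a b} → a < b → ¬ (b < a)
  <-asym p q = <-irrefl refl (<-trans p q)

  ≤⇒≯ : ∀ {a b} → a ≤ b → ¬ (b < a)
  ≤⇒≯ (inj₁ a<b)  b<a = <-asym a<b b<a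
  ≤⇒≯ (inj₂ refl) b<a = <-irrefl refl b<a

  ≤-antisym : ∀ {a b} → a ≤ b → b ≤ a → a ≡ b
  ≤-antisym a≤b (inj₁ b<a)  = contradiction b<a (≤⇒≯ a≤b)
  ≤-antisym a≤b (inj₂ refl) = refl

  ≤-trans : ∀ {a b d} → a ≤ b → b ≤ d → a ≤ d
  ≤-trans (inj₁ p)    (inj₁ q)    = inj₁ (<-trans p q)
  ≤-trans (inj₁ p)    (inj₂ refl) = inj₁ p
  ≤-trans (inj₂ refl) q           = q

  ≤-<-trans : ∀ {a b d} → a ≤ b → b < d → a < d
  ≤-<-trans (inj₁ p)    q = <-trans p q
  ≤-<-trans (inj₂ refl) q = q

  <-≤-trans : ∀ {a b d} → a < b → b ≤ d → a < d
  <-≤-trans p (inj₁ q)    = <-trans p q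
  <-≤-trans p (inj₂ refl) = p

  ≤∧≢⇒< : ∀ {a b} → a ≤ b → a ≢ b → a < b
  ≤∧≢⇒< (inj₁ a<b) _   = a<b
  ≤∧≢⇒< (inj₂ a≡b) a≢b = contradiction a≡b a≢b

  a<b⇒0<b-a : ∀ {a b} → a < b → 0# < b - a
  a<b⇒0<b-a {a} {b} a<b =
    subst₂ _<_ (solve 1 (λ a → :- a :+ a := con 0ℤ) refl a) (+-comm (- a) b) (+-monoʳ-< (- a) a<b)

  0<b-a⇒a<b : ∀ {a b} → 0# < b - a → a < b
  0<b-a⇒a<b {a} {b} p =
    subst₂ _<_ (+-identityʳ a) (solve 2 (λ a b → a :+ (b :- a) := b) refl a b) (+-monoʳ-< a p)

  neg-pos : ∀ {a} → a < 0# → 0# < - a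
  neg-pos a<0 = <-respʳ (a<b⇒0<b-a a<0) (+-identityˡ _)

  *-cancel-zero : ∀ {a b} → a ≢ 0# → a * b ≡ 0# → b ≡ 0#
  *-cancel-zero {a} {b} a≢0 ab≡0 with inverse a a≢0
  ... | a⁻¹ , aa⁻¹≡1 = begin
    b              ≡⟨ *-identityˡ b ⟨
    1# * b         ≡⟨ cong (_* b) aa⁻¹≡1 ⟨
    a * a⁻¹ * b    ≡⟨ solve 3 (λ a a⁻¹ b → a :* a⁻¹ :* b := a⁻¹ :* (a :* b)) refl a a⁻¹ b ⟩
    a⁻¹ * (a * b)  ≡⟨ cong (a⁻¹ *_) ab≡0 ⟩
    a⁻¹ * 0#       ≡⟨ zeroʳ a⁻¹ ⟩
    0#             ∎

  *-cancel-pos : ∀ {a b} → 0# < a → 0# < a * b → 0# < b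
  *-cancel-pos {a} {b} 0<a 0<ab with compare 0# b
  ... | tri< 0<b _ _  = 0<b
  ... | tri≈ _ refl _ = contradiction (<-respʳ 0<ab (zeroʳ a)) (<-irrefl refl)
  ... | tri> _ _ b<0  = contradiction
    (<-respʳ (+-monoʳ-< (a * b) (*-pos 0<a (neg-pos b<0)))
      (solve 2 (λ a b → a :* b :+ a :* :- b := con 0ℤ) refl a b))
    (<-asym (<-respʳ 0<ab (sym (+-identityʳ _))))

  private
    ν-pos : ∀ n → 0# < ν (suc n)
    ν-pos zero    = <-respʳ 0<1 (sym (+-identityʳ 1#))
    ν-pos (suc n) = <-trans 0<1 (<-respˡ (+-monoʳ-< 1# (ν-pos n)) (+-identityʳ 1#))

  ι-pos : ∀ {i} → 0ℤ ℤ.< i → 0# < ι i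
  ι-pos {nat (suc n)} _          = ν-pos n
  ι-pos {nat zero}    (ℤ.+<+ ())

  ι-mono : ∀ {i j} → i ℤ.< j → ι i < ι j
  ι-mono {i} {j} i<j = 0<b-a⇒a<b (<-respʳ
    (ι-pos (subst (ℤ._< j ℤ.- i) (ℤ.+-inverseʳ i) (ℤ.+-monoˡ-< (ℤ.- i) i<j)))
    (trans (ι-+ j (ℤ.- i)) (cong (ι j +_) (ι-neg i))))

  ι-mono-≤ : ∀ {i j} → i ℤ.≤ j → ι i ≤ ι j
  ι-mono-≤ {i} {j} i≤j with i ℤ.≟ j
  ... | yes refl = inj₂ refl
  ... | no i≢j   = inj₁ (ι-mono (ℤ.≤∧≢⇒< i≤j i≢j))

  -- The order on ℤ is total, so the strictly monotone `ι` also reflects it.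
  ι-cancel-< : ∀ {i j} → ι i < ι j → i ℤ.< j
  ι-cancel-< {i} {j} p = ℤ.≰⇒> λ j≤i → ≤⇒≯ (ι-mono-≤ j≤i) p

  ι-cancel-≤ : ∀ {i j} → ι i ≤ ι j → i ℤ.≤ j
  ι-cancel-≤ {i} {j} p = ℤ.≮⇒≥ λ j<i → ≤⇒≯ p (ι-mono j<i)

  ι-injective : ∀ {i j} → ι i ≡ ι j → i ≡ j
  ι-injective p = ℤ.≤-antisym (ι-cancel-≤ (inj₂ p)) (ι-cancel-≤ (inj₂ (sym p)))

  ι-minus : ∀ i j → ι (i ℤ.- j) ≡ ι i - ι j
  ι-minus i j = trans (ι-+ i (ℤ.- j)) (cong (ι i +_) (ι-neg j))

  ι-det : ∀ i j k l → ι (i ℤ.* j ℤ.- k ℤ.* l) ≡ ι i * ι j - ι k * ι l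
  ι-det i j k l = trans (ι-minus (i ℤ.* j) (k ℤ.* l)) (cong₂ _-_ (ι-* i j) (ι-* k l))

  abstract
    -- The midpoint, with `h` one half.
    dense : ∀ {a b} → a < b → ∃[ m ] a < m × m < b
    dense {a} {b} a<b = a + h * (b - a) ,
      <-respˡ (+-monoʳ-< a step) (+-identityʳ a) ,
      subst₂ _<_ (+-identityʳ _) a+h+h (+-monoʳ-< (a + h * (b - a)) step)
      where
      0<2 : 0# < ν 2
      0<2 = ν-pos 1
      h : Carrier
      h = proj₁ (inverse (ν 2) (λ 2≡0 → <⇒≢ 0<2 (sym 2≡0)))
      2h≡1 : ν 2 * h ≡ 1#
      2h≡1 = proj₂ (inverse (ν 2) (λ 2≡0 → <⇒≢ 0<2 (sym 2≡0)))
      0<h : 0# < h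
      0<h = *-cancel-pos 0<2 (<-respʳ 0<1 (sym 2h≡1))
      step : 0# < h * (b - a)
      step = *-pos 0<h (a<b⇒0<b-a a<b)
      a+h+h : a + h * (b - a) + h * (b - a) ≡ b
      a+h+h = begin
        a + h * (b - a) + h * (b - a)  ≡⟨ solve 3 (λ a b h → a :+ h :* (b :- a) :+ h :* (b :- a)
                                            := a :+ (con (nat 2) :* h) :* (b :- a)) refl a b h ⟩
        a + (ν 2 * h) * (b - a)        ≡⟨ cong (λ w → a + w * (b - a)) 2h≡1 ⟩
        a + 1# * (b - a)               ≡⟨ cong (a +_) (*-identityˡ _) ⟩
        a + (b - a)                    ≡⟨ solve 2 (λ a b → a :+ (b :- a) := b) refl a b ⟩
        b                              ∎

module Points {c ℓ : Level} (K : OrderedField c ℓ) where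
  open Field K public
  open Plane K public hiding (Port; north; south; east; west; Towards)

  _≟ᴾ_ : DecidableEquality Point
  p ≟ᴾ q = map′ (λ (e , f) → cong₂ ⟨_,_⟩ e f) (λ e → cong x e , cong y e)
                (x p ≟ x q ×-dec y p ≟ y q)

-- Turns and ports

data Turn : Set where
  right ahead left : Turn

reverse : Turn → Turn
reverse right = left
reverse ahead = ahead
reverse left  = right

⟦_⟧ : Turn → ℤ
⟦ right ⟧ = -1ℤ
⟦ ahead ⟧ = 0ℤ
⟦ left ⟧  = 1ℤ

∀turn? : ∀ {p} {P : Pred Turn p} → (∀ t → Dec (P t)) → Dec (∀ t → P t)
∀turn? P? = map′ (λ { (r , a , l) → λ { right → r ; ahead → a ; left → l } })
                 (λ f → f right , f ahead , f left)
                 (P? right ×-dec P? ahead ×-dec P? left)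

_≟ᵗ_ : DecidableEquality Turn
right ≟ᵗ right = yes refl
right ≟ᵗ ahead = no λ ()
right ≟ᵗ left  = no λ ()
ahead ≟ᵗ right = no λ ()
ahead ≟ᵗ ahead = yes refl
ahead ≟ᵗ left  = no λ ()
left  ≟ᵗ right = no λ ()
left  ≟ᵗ ahead = no λ ()
left  ≟ᵗ left  = yes refl

total : List Turn → ℤ
total []       = 0ℤ
total (t ∷ ts) = ⟦ t ⟧ ℤ.+ total ts

Around : List Turn → Set
Around ts = total ts ≡ nat 4 ⊎ total ts ≡ ℤ.- nat 4

around? : ∀ ts → Dec (Around ts)
around? ts = (total ts ℤ.≟ nat 4) ⊎-dec (total ts ℤ.≟ ℤ.- nat 4)

-- A copy of Plane.Port that does not depend on the field, which keeps the exhaustive checks cheap.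
data Port : Set where
  north south east west : Port

veer : Turn → Port → Port
veer ahead p     = p
veer left  north = west
veer left  west  = south
veer left  south = east
veer left  east  = north
veer right north = east
veer right east  = south
veer right south = west
veer right west  = north

opp : Port → Port
opp p = veer left (veer left p)

∀port? : ∀ {p} {P : Pred Port p} → (∀ π → Dec (P π)) → Dec (∀ π → P π)
∀port? P? = map′ (λ { (n , s , e , w) → λ { north → n ; south → s ; east → e ; west → w } })
                 (λ f → f north , f south , f east , f west)
                 (P? north ×-dec P? south ×-dec P? east ×-dec P? west)

_≟ᵖ_ : DecidableEquality Port
north ≟ᵖ north = yes refl
north ≟ᵖ south = no λ ()
north ≟ᵖ east  = no λ ()
north ≟ᵖ west  = no λ ()
south ≟ᵖ north = no λ ()
south ≟ᵖ south = yes refl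
south ≟ᵖ east  = no λ ()
south ≟ᵖ west  = no λ ()
east  ≟ᵖ north = no λ ()
east  ≟ᵖ south = no λ ()
east  ≟ᵖ east  = yes refl
east  ≟ᵖ west  = no λ ()
west  ≟ᵖ north = no λ ()
west  ≟ᵖ south = no λ ()
west  ≟ᵖ east  = no λ ()
west  ≟ᵖ west  = yes refl

opp-opp : ∀ p → opp (opp p) ≡ p
opp-opp north = refl
opp-opp south = refl
opp-opp east  = refl
opp-opp west  = refl

veer-reverse : ∀ t p → veer (reverse t) (opp (veer t p)) ≡ opp p
veer-reverse = from-yes (∀turn? λ t → ∀port? λ p → veer (reverse t) (opp (veer t p)) ≟ᵖ opp p)

-- The sides of a hexagon that turns left three times, starting after its side p₀, and then right
-- three times.  It is the only way to have total turning 0 and to use all four ports.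
Zigzag : Port → Port → Port → Port → Port → Port → Set
Zigzag p₀ p₁ p₂ p₃ p₄ p₅ =
  p₁ ≡ veer left p₀ × p₂ ≡ veer left p₁ × p₃ ≡ veer left p₂ × p₄ ≡ p₂ × p₅ ≡ p₁

zigzag? : ∀ p₀ p₁ p₂ p₃ p₄ p₅ → Dec (Zigzag p₀ p₁ p₂ p₃ p₄ p₅)
zigzag? p₀ p₁ p₂ p₃ p₄ p₅ =
  (p₁ ≟ᵖ _) ×-dec (p₂ ≟ᵖ _) ×-dec (p₃ ≟ᵖ _) ×-dec (p₄ ≟ᵖ _) ×-dec (p₅ ≟ᵖ _)

-- All six cyclic shifts of the zigzag, paired by the opposite sides that cross: 0 and 3, 1 and 4, 2
-- and 5. Three right turns followed by three left turns are the same cyclic sequence, so the mirror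
-- image is included.
SelfCrossing : Port → Port → Port → Port → Port → Port → Set
SelfCrossing p₀ p₁ p₂ p₃ p₄ p₅ =
  (Zigzag p₀ p₁ p₂ p₃ p₄ p₅ ⊎ Zigzag p₃ p₄ p₅ p₀ p₁ p₂) ⊎
  (Zigzag p₁ p₂ p₃ p₄ p₅ p₀ ⊎ Zigzag p₄ p₅ p₀ p₁ p₂ p₃) ⊎
  (Zigzag p₂ p₃ p₄ p₅ p₀ p₁ ⊎ Zigzag p₅ p₀ p₁ p₂ p₃ p₄)

selfCrossing? : ∀ p₀ p₁ p₂ p₃ p₄ p₅ → Dec (SelfCrossing p₀ p₁ p₂ p₃ p₄ p₅)
selfCrossing? p₀ p₁ p₂ p₃ p₄ p₅ =
  (zigzag? p₀ p₁ p₂ p₃ p₄ p₅ ⊎-dec zigzag? p₃ p₄ p₅ p₀ p₁ p₂) ⊎-dec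
  (zigzag? p₁ p₂ p₃ p₄ p₅ p₀ ⊎-dec zigzag? p₄ p₅ p₀ p₁ p₂ p₃) ⊎-dec
  (zigzag? p₂ p₃ p₄ p₅ p₀ p₁ ⊎-dec zigzag? p₅ p₀ p₁ p₂ p₃ p₄)

Unbalanced : List Port → Set
Unbalanced ps = Any (λ q → opp q ∉ ps) ps

unbalanced? : ∀ ps → Dec (Unbalanced ps)
unbalanced? ps = any? (λ q → ¬? (any? (opp q ≟ᵖ_) ps)) ps

abstract
  -- Returning to the initial direction makes the total a multiple of 4, and six turns bound it by 6
  -- in absolute value; only the total 0 has to be explained away. The check runs through the 4 · 3⁶
  -- sequences.
  hexagon-turns : ∀ p₀ t₀ t₁ t₂ t₃ t₄ t₅ →
    let p₁ = veer t₀ p₀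
        p₂ = veer t₁ p₁
        p₃ = veer t₂ p₂
        p₄ = veer t₃ p₃
        p₅ = veer t₄ p₄ in
    veer t₅ p₅ ≡ p₀ →
    Around (t₀ ∷ t₁ ∷ t₂ ∷ t₃ ∷ t₄ ∷ t₅ ∷ []) ⊎
    Unbalanced (p₀ ∷ p₁ ∷ p₂ ∷ p₃ ∷ p₄ ∷ p₅ ∷ []) ⊎
    SelfCrossing p₀ p₁ p₂ p₃ p₄ p₅
  hexagon-turns = from-yes
    (∀port? λ p₀ → ∀turn? λ t₀ → ∀turn? λ t₁ → ∀turn? λ t₂ →
     ∀turn? λ t₃ → ∀turn? λ t₄ → ∀turn? λ t₅ →
    let p₁ = veer t₀ p₀
        p₂ = veer t₁ p₁
        p₃ = veer t₂ p₂
        p₄ = veer t₃ p₃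
        p₅ = veer t₄ p₄ in
    (veer t₅ p₅ ≟ᵖ p₀) →-dec
    (around? (t₀ ∷ t₁ ∷ t₂ ∷ t₃ ∷ t₄ ∷ t₅ ∷ []) ⊎-dec
     unbalanced? (p₀ ∷ p₁ ∷ p₂ ∷ p₃ ∷ p₄ ∷ p₅ ∷ []) ⊎-dec
     selfCrossing? p₀ p₁ p₂ p₃ p₄ p₅))

-- Closed rectilinear hexagons

module Rectilinear {c ℓ : Level} (K : OrderedField c ℓ) where
  open Points K public

  Towards : Port → Rel Point (c ⊔ ℓ)
  Towards north A B = x A ≡ x B × y A < y B
  Towards south A B = x A ≡ x B × y B < y A
  Towards east  A B = x A < x B × y A ≡ y B
  Towards west  A B = x B < x A × y A ≡ y B

  Towards-opp : ∀ p {A B} → Towards p A B → Towards (opp p) B A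
  Towards-opp north (e , l) = sym e , l
  Towards-opp south (e , l) = sym e , l
  Towards-opp east  (l , e) = l , sym e
  Towards-opp west  (l , e) = l , sym e

  Towards-unopp : ∀ p {A B} → Towards (opp p) A B → Towards p B A
  Towards-unopp p {A} {B} t = subst (λ q → Towards q B A) (opp-opp p) (Towards-opp (opp p) t)

  Towards-trans : ∀ p {A B C} → Towards p A B → Towards p B C → Towards p A C
  Towards-trans north (e , l) (f , m) = trans e f , <-trans l m
  Towards-trans south (e , l) (f , m) = trans e f , <-trans m l
  Towards-trans east  (l , e) (m , f) = <-trans l m , trans e f
  Towards-trans west  (l , e) (m , f) = <-trans m l , trans e f

  no-backtrack : ∀ p t {A B} → Towards p A B → ¬ Towards (veer t p) B A
  no-backtrack north right (e , l) (l′ , e′) = <-irrefl (sym e) l′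
  no-backtrack north ahead (e , l) (e′ , l′) = <-asym l l′
  no-backtrack north left  (e , l) (l′ , e′) = <-irrefl e l′
  no-backtrack south right (e , l) (l′ , e′) = <-irrefl e l′
  no-backtrack south ahead (e , l) (e′ , l′) = <-asym l l′
  no-backtrack south left  (e , l) (l′ , e′) = <-irrefl (sym e) l′
  no-backtrack east  right (l , e) (e′ , l′) = <-irrefl e l′
  no-backtrack east  ahead (l , e) (l′ , e′) = <-asym l l′
  no-backtrack east  left  (l , e) (e′ , l′) = <-irrefl (sym e) l′
  no-backtrack west  right (l , e) (e′ , l′) = <-irrefl (sym e) l′
  no-backtrack west  ahead (l , e) (l′ , e′) = <-asym l l′
  no-backtrack west  left  (l , e) (e′ , l′) = <-irrefl e l′

  infixr 5 _∷_
  data Walk : Point → List Port → Point → Set (c ⊔ ℓ) where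
    []  : ∀ {A} → Walk A [] A
    _∷_ : ∀ {A B C p ps} → Towards p A B → Walk B ps C → Walk A (p ∷ ps) C

  private
    -- The coordinate that grows in the direction of the port; only a step towards the opposite port
    -- lowers it.
    height : Port → Point → Carrier
    height north A = y A
    height south A = - y A
    height east  A = x A
    height west  A = - x A

    neg-anti : ∀ {a b} → a < b → - b < - a
    neg-anti {a} {b} a<b = 0<b-a⇒a<b (<-respʳ (a<b⇒0<b-a a<b)
      (solve 2 (λ a b → b :- a := :- a :- :- b) refl a b))

    step< : ∀ q {A B} → Towards q A B → height q A < height q B
    step< north (_ , l) = l
    step< south (_ , l) = neg-anti l
    step< east  (l , _) = l
    step< west  (l , _) = neg-anti l

    step≤ : ∀ p q {A B} → Towards p A B → p ≢ opp q → height q A ≤ height q B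
    step≤ north north t       _ = inj₁ (step< north t)
    step≤ north south t       n = contradiction refl n
    step≤ north east  (e , _) _ = inj₂ e
    step≤ north west  (e , _) _ = inj₂ (cong -_ e)
    step≤ south north t       n = contradiction refl n
    step≤ south south t       _ = inj₁ (step< south t)
    step≤ south east  (e , _) _ = inj₂ e
    step≤ south west  (e , _) _ = inj₂ (cong -_ e)
    step≤ east  north (_ , e) _ = inj₂ e
    step≤ east  south (_ , e) _ = inj₂ (cong -_ e)
    step≤ east  east  t       _ = inj₁ (step< east t)
    step≤ east  west  t       n = contradiction refl n
    step≤ west  north (_ , e) _ = inj₂ e
    step≤ west  south (_ , e) _ = inj₂ (cong -_ e)
    step≤ west  east  t       n = contradiction refl n
    step≤ west  west  t       _ = inj₁ (step< west t)

    walk≤ : ∀ q {A B ps} → Walk A ps B → opp q ∉ ps → height q A ≤ height q B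
    walk≤ q []      _ = inj₂ refl
    walk≤ q (t ∷ w) n = ≤-trans (step≤ _ q t (n ∘ here ∘ sym)) (walk≤ q w (n ∘ there))

    walk< : ∀ {q A B ps} → Walk A ps B → q ∈ ps → opp q ∉ ps → height q A < height q B
    walk< {q} (t ∷ w) (here refl) n = <-≤-trans (step< q t) (walk≤ q w (n ∘ there))
    walk< {q} (t ∷ w) (there i)   n = ≤-<-trans (step≤ _ q t (n ∘ here ∘ sym)) (walk< w i (n ∘ there))

  Along : Port → Point → Point → Point → Set (c ⊔ ℓ)
  Along p A B r = Towards p A r × Towards p r B

  -- Sides 2 and 4 point the same way and put the line of side 3 strictly between the ends of side
  -- 0; sides 1 and 5 do the same for the line of side 0 and the ends of side 3. The crossing is
  -- therefore where the two lines meet.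
  zigzag-crosses : ∀ {p₀ p₁ p₂ p₃ p₄ p₅} → Zigzag p₀ p₁ p₂ p₃ p₄ p₅ →
    ∀ {A₀ A₁ A₂ A₃ A₄ A₅} →
    Towards p₀ A₀ A₁ → Towards p₁ A₁ A₂ → Towards p₂ A₂ A₃ →
    Towards p₃ A₃ A₄ → Towards p₄ A₄ A₅ → Towards p₅ A₅ A₀ →
    ∃[ r ] Along p₀ A₀ A₁ r × Along p₃ A₃ A₄ r
  zigzag-crosses {east} (refl , refl , refl , refl , refl) {A₀} {A₃ = A₃}
    (_ , refl) (refl , u) (l , refl) (refl , _) (m , refl) (refl , v) =
    ⟨ x A₃ , y A₀ ⟩ , ((m , refl) , (l , refl)) , ((refl , u) , (refl , v))
  zigzag-crosses {west} (refl , refl , refl , refl , refl) {A₀} {A₃ = A₃}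
    (_ , refl) (refl , u) (l , refl) (refl , _) (m , refl) (refl , v) =
    ⟨ x A₃ , y A₀ ⟩ , ((m , refl) , (l , refl)) , ((refl , u) , (refl , v))
  zigzag-crosses {north} (refl , refl , refl , refl , refl) {A₀} {A₃ = A₃}
    (refl , _) (u , refl) (refl , l) (_ , refl) (refl , m) (v , refl) =
    ⟨ x A₀ , y A₃ ⟩ , ((refl , m) , (refl , l)) , ((u , refl) , (v , refl))
  zigzag-crosses {south} (refl , refl , refl , refl , refl) {A₀} {A₃ = A₃}
    (refl , _) (u , refl) (refl , l) (_ , refl) (refl , m) (v , refl) =
    ⟨ x A₀ , y A₃ ⟩ , ((refl , m) , (refl , l)) , ((u , refl) , (v , refl))

  -- If `q` occurs without its opposite, the coordinate in direction `q` never decreases along the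
  -- walk and increases at least once.
  unbalanced⇒¬closed : ∀ {A ps} → Unbalanced ps → ¬ Walk A ps A
  unbalanced⇒¬closed {ps = ps} u w with find u
  ... | q , i , n = <-irrefl refl (walk< w i n)

  -- A path with one corner, whose turn may be `ahead`. In the applications `S` is the whole edge
  -- that contains the path, so half-edges inherit what is known about the common points of edges.
  record Route (A B : Point) (p : Port) (t : Turn) (q : Port) (S : Point → Set (c ⊔ ℓ)) :
               Set (c ⊔ ℓ) where
    field
      corner    : Point
      turning   : veer t p ≡ q
      depart    : Towards p A corner
      arrive    : Towards q corner B
      departing : ∀ {r} → Along p A corner r → S r
      arriving  : ∀ {r} → Along q corner B r → S r

  open Route public

  -- With the last index written `opp q`, both `p` and `q` point away from the ends of the path, and
  -- reversal merely swaps them.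
  backwards : ∀ {A B p t q S} → Route A B p t (opp q) S → Route B A q (reverse t) (opp p) S
  backwards {p = p} {t} {q} R = record
    { corner = corner R
    ; turning = trans (cong (veer (reverse t)) (trans (sym (opp-opp q)) (cong opp (sym (turning R)))))
                      (veer-reverse t p)
    ; depart = Towards-unopp q (arrive R)
    ; arrive = Towards-opp p (depart R)
    ; departing = λ (b , a) → arriving R (Towards-opp q a , Towards-opp q b)
    ; arriving = λ (b , a) → departing R (Towards-unopp p a , Towards-unopp p b)
    }

  private
    between : ∀ p {A B} → Towards p A B → ∃[ m ] Along p A B m
    between north {A} (refl , l) with dense l
    ... | m , l₁ , l₂ = ⟨ x A , m ⟩ , (refl , l₁) , (refl , l₂)
    between south {A} (refl , l) with dense l
    ... | m , l₁ , l₂ = ⟨ x A , m ⟩ , (refl , l₂) , (refl , l₁)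
    between east  {A} (l , refl) with dense l
    ... | m , l₁ , l₂ = ⟨ m , y A ⟩ , (l₁ , refl) , (l₂ , refl)
    between west  {A} (l , refl) with dense l
    ... | m , l₁ , l₂ = ⟨ m , y A ⟩ , (l₂ , refl) , (l₁ , refl)

  -- A straight route gets a dummy corner in its middle, so that all kites are hexagons.
  straight-route : ∀ p {A B S} → Towards p A B → (∀ {r} → Along p A B r → S r) →
                   Route A B p ahead p S
  straight-route p AB S with between p AB
  ... | m , Am , mB = record
    { corner = m ; turning = refl ; depart = Am ; arrive = mB
    ; departing = λ (Ar , rm) → S (Ar , Towards-trans p rm mB)
    ; arriving = λ (mr , rB) → S (Towards-trans p Am mr , rB)
    }

  -- It remains to exclude a zigzag. Opposite sides of the hexagon always belong to different
  -- routes, so their crossing would have to be the end shared by these routes. One of the routes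
  -- would then pass through its own end on its other side, which means doubling back at its corner.
  kite : ∀ {A B C p₁ q₁ p₂ q₂ p₃ q₃ t₁ t₂ t₃ s₁ s₂ s₃ S₁ S₂ S₃} →
    Route A B p₁ t₁ q₁ S₁ → veer s₁ q₁ ≡ p₂ →
    Route B C p₂ t₂ q₂ S₂ → veer s₂ q₂ ≡ p₃ →
    Route C A p₃ t₃ q₃ S₃ → veer s₃ q₃ ≡ p₁ →
    (∀ {r} → S₁ r → S₂ r → r ≡ B) →
    (∀ {r} → S₂ r → S₃ r → r ≡ C) →
    (∀ {r} → S₃ r → S₁ r → r ≡ A) →
    Around (t₁ ∷ s₁ ∷ t₂ ∷ s₂ ∷ t₃ ∷ s₃ ∷ [])
  kite {p₁ = p₁} {p₂ = p₂} {t₁ = t₁} {t₂} {t₃} {s₁} {s₂} {s₃} {S₁} {S₂} {S₃}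
    R₁@record { turning = refl } refl R₂@record { turning = refl } refl R₃@record { turning = refl } e₃
    meet₁₂ meet₂₃ meet₃₁
    with hexagon-turns p₁ t₁ s₁ t₂ s₂ t₃ s₃ e₃
  ... | inj₁ around   = around
  ... | inj₂ (inj₁ u) = contradiction
    (depart R₁ ∷ arrive R₁ ∷ depart R₂ ∷ arrive R₂ ∷ depart R₃ ∷ arrive R₃ ∷ [])
    (unbalanced⇒¬closed u)
  ... | inj₂ (inj₂ (inj₁ z)) = ⊥-elim (0∩3 (cross z))
    where
    0∩3 : ¬ (∃[ r ] Along p₁ _ (corner R₁) r × Along _ (corner R₂) _ r)
    0∩3 (r , a , b) with meet₁₂ (departing R₁ a) (arriving R₂ b)
    ... | refl = no-backtrack p₁ t₁ (proj₂ a) (arrive R₁)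
    cross : _ → _
    cross (inj₁ z) = zigzag-crosses z (depart R₁) (arrive R₁) (depart R₂) (arrive R₂) (depart R₃) (arrive R₃)
    cross (inj₂ z) with zigzag-crosses z (arrive R₂) (depart R₃) (arrive R₃) (depart R₁) (arrive R₁) (depart R₂)
    ... | r , b , a = r , a , b
  ... | inj₂ (inj₂ (inj₂ (inj₁ z))) = ⊥-elim (1∩4 (cross z))
    where
    1∩4 : ¬ (∃[ r ] Along _ (corner R₁) _ r × Along _ _ (corner R₃) r)
    1∩4 (r , a , b) with meet₃₁ (departing R₃ b) (arriving R₁ a)
    ... | refl = no-backtrack p₁ t₁ (depart R₁) (proj₁ a)
    cross : _ → _
    cross (inj₁ z) = zigzag-crosses z (arrive R₁) (depart R₂) (arrive R₂) (depart R₃) (arrive R₃) (depart R₁)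
    cross (inj₂ z) with zigzag-crosses z (depart R₃) (arrive R₃) (depart R₁) (arrive R₁) (depart R₂) (arrive R₂)
    ... | r , b , a = r , a , b
  ... | inj₂ (inj₂ (inj₂ (inj₂ z))) = ⊥-elim (2∩5 (cross z))
    where
    2∩5 : ¬ (∃[ r ] Along _ _ (corner R₂) r × Along _ (corner R₃) _ r)
    2∩5 (r , a , b) with meet₂₃ (departing R₂ a) (arriving R₃ b)
    ... | refl = no-backtrack p₂ t₂ (proj₂ a) (arrive R₂)
    cross : _ → _
    cross (inj₁ z) = zigzag-crosses z (depart R₂) (arrive R₂) (depart R₃) (arrive R₃) (depart R₁) (arrive R₁)
    cross (inj₂ z) with zigzag-crosses z (arrive R₃) (depart R₁) (arrive R₁) (depart R₂) (arrive R₂) (depart R₃)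
    ... | r , b , a = r , a , b

-- The kites of K₄

-- The arguments of Around are the turns met along a kite: half-edge from the crossing, first vertex,
-- edge, second vertex, half-edge to the crossing, crossing.
abstract
  -- If `ε` were right, Xab would need `hᵃ + eᵃᵇ - hᵇ = 3`, hence `hᵇ` right. Then Xbc would need
  -- `eᵇᶜ + τ - hᶜ` to be 5 or -3, and the latter needs `τ` right.
  crossing-left : ∀ ε → ε ≢ ahead → ∀ τ → τ ≢ right → ∀ hᵃ hᵇ hᶜ eᵃᵇ eᵇᶜ →
    Around (hᵃ ∷ left ∷ eᵃᵇ ∷ left ∷ reverse hᵇ ∷ ε ∷ []) →
    Around (hᵇ ∷ left ∷ eᵇᶜ ∷ τ ∷ reverse hᶜ ∷ ε ∷ []) →
    ε ≡ left
  crossing-left = from-yes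
    (∀turn? λ ε → ¬? (ε ≟ᵗ ahead) →-dec ∀turn? λ τ → ¬? (τ ≟ᵗ right) →-dec
     ∀turn? λ hᵃ → ∀turn? λ hᵇ → ∀turn? λ hᶜ → ∀turn? λ eᵃᵇ → ∀turn? λ eᵇᶜ →
     around? (hᵃ ∷ left ∷ eᵃᵇ ∷ left ∷ reverse hᵇ ∷ ε ∷ []) →-dec
     around? (hᵇ ∷ left ∷ eᵇᶜ ∷ τ ∷ reverse hᶜ ∷ ε ∷ []) →-dec (ε ≟ᵗ left))

  -- As `σ` and `τ` are not negative, the total cannot be -4. The total 4 gives
  -- `h - h′ = 3 - σ - e - τ`, which is at least 0.
  half-edge-≤ : ∀ σ → σ ≢ right → ∀ τ → τ ≢ right → ∀ h e h′ →
    Around (h ∷ σ ∷ e ∷ τ ∷ reverse h′ ∷ left ∷ []) → ⟦ h′ ⟧ ℤ.≤ ⟦ h ⟧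
  half-edge-≤ = from-yes
    (∀turn? λ σ → ¬? (σ ≟ᵗ right) →-dec ∀turn? λ τ → ¬? (τ ≟ᵗ right) →-dec
     ∀turn? λ h → ∀turn? λ e → ∀turn? λ h′ →
     around? (h ∷ σ ∷ e ∷ τ ∷ reverse h′ ∷ left ∷ []) →-dec (⟦ h′ ⟧ ℤ.≤? ⟦ h ⟧))

  -- Three left turns leave `h + e - h′ = 1`, so `e` is at least 1.
  inner-edge-left : ∀ h e h′ → ⟦ h ⟧ ℤ.≤ ⟦ h′ ⟧ →
    Around (h ∷ left ∷ e ∷ left ∷ reverse h′ ∷ left ∷ []) → e ≡ left
  inner-edge-left = from-yes
    (∀turn? λ h → ∀turn? λ e → ∀turn? λ h′ →
     (⟦ h ⟧ ℤ.≤? ⟦ h′ ⟧) →-dec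
     around? (h ∷ left ∷ e ∷ left ∷ reverse h′ ∷ left ∷ []) →-dec (e ≟ᵗ left))

  -- The vertices and the reflex bend contribute 1, so `g - g′ + ε` must be 3 and every term is
  -- extreme.
  outer-half-edge-left : ∀ g g′ ε →
    Around (g ∷ left ∷ right ∷ left ∷ reverse g′ ∷ ε ∷ []) → g ≡ left
  outer-half-edge-left = from-yes
    (∀turn? λ g → ∀turn? λ g′ → ∀turn? λ ε →
     around? (g ∷ left ∷ right ∷ left ∷ reverse g′ ∷ ε ∷ []) →-dec (g ≟ᵗ left))

half-edge-bends : ∀ {ε δ τᶜ σᶜ τᵈ σᵈ hᵃ hᵇ hᶜ hᵈ eᵃᵇ eᵇᶜ eᶜᵈ eᵈᵃ gᵃ gᵇ} → ε ≢ ahead →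
  τᶜ ≢ right → σᶜ ≢ right → τᵈ ≢ right → σᵈ ≢ right →
  Around (hᵃ ∷ left ∷ eᵃᵇ ∷ left ∷ reverse hᵇ ∷ ε ∷ []) →
  Around (hᵇ ∷ left ∷ eᵇᶜ ∷ τᶜ ∷ reverse hᶜ ∷ ε ∷ []) →
  Around (hᶜ ∷ σᶜ ∷ eᶜᵈ ∷ τᵈ ∷ reverse hᵈ ∷ ε ∷ []) →
  Around (hᵈ ∷ σᵈ ∷ eᵈᵃ ∷ left ∷ reverse hᵃ ∷ ε ∷ []) →
  Around (gᵇ ∷ left ∷ reverse eᵃᵇ ∷ left ∷ reverse gᵃ ∷ δ ∷ []) →
  gᵇ ≡ left
half-edge-bends {δ = δ} {hᵃ = hᵃ} {hᵇ} {hᶜ} {hᵈ} {eᵃᵇ} {eᵇᶜ} {eᶜᵈ} {eᵈᵃ} {gᵃ} {gᵇ}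
  ε≢ahead τᶜ σᶜ τᵈ σᵈ ab bc cd da ba
  with crossing-left _ ε≢ahead _ τᶜ hᵃ hᵇ hᶜ eᵃᵇ eᵇᶜ ab bc
... | refl
  -- The chain is `hᵃ ≤ hᵈ ≤ hᶜ ≤ hᵇ`, from Xda, Xcd and Xbc in turn.
  with inner-edge-left hᵃ eᵃᵇ hᵇ
         (ℤ.≤-trans (half-edge-≤ _ σᵈ left (λ ()) hᵈ eᵈᵃ hᵃ da)
           (ℤ.≤-trans (half-edge-≤ _ σᶜ _ τᵈ hᶜ eᶜᵈ hᵈ cd)
                      (half-edge-≤ left (λ ()) _ τᶜ hᵇ eᵇᶜ hᶜ bc))) ab
... | refl = outer-half-edge-left gᵇ gᵃ δ ba

-- Ports at crossings and around vertices

unitˣ unitʸ : Port → ℤ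
unitˣ north = 0ℤ
unitˣ south = 0ℤ
unitˣ east  = 1ℤ
unitˣ west  = -1ℤ
unitʸ north = 1ℤ
unitʸ south = -1ℤ
unitʸ east  = 0ℤ
unitʸ west  = 0ℤ

unit-det : Port → Port → ℤ
unit-det p q = unitˣ p ℤ.* unitʸ q ℤ.- unitʸ p ℤ.* unitˣ q

unit-det-left : ∀ p q → 0ℤ ℤ.< unit-det p q → q ≡ veer left p
unit-det-left = from-yes
  (∀port? λ p → ∀port? λ q → (0ℤ ℤ.<? unit-det p q) →-dec (q ≟ᵖ veer left p))

-- p and q point away from a crossing; a path that comes from the side of q and leaves towards p
-- turns by ε.
record Perp (ε : Turn) (p q : Port) : Set where
  constructor perp
  field
    ε≢ahead  : ε ≢ ahead
    turns-by : veer ε (opp q) ≡ p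

unit-det-perp : ∀ p q → unit-det p q ≢ 0ℤ → ∃[ ε ] Perp ε p q
unit-det-perp p q n with sides p q n
  where
  sides : ∀ p q → unit-det p q ≢ 0ℤ → veer left (opp q) ≡ p ⊎ veer right (opp q) ≡ p
  sides = from-yes (∀port? λ p → ∀port? λ q → ¬? (unit-det p q ℤ.≟ 0ℤ) →-dec
    ((veer left (opp q) ≟ᵖ p) ⊎-dec (veer right (opp q) ≟ᵖ p)))
... | inj₁ e = left , perp (λ ()) e
... | inj₂ e = right , perp (λ ()) e

-- The two halves of an edge leave a crossing in opposite directions, so this passes from one kite
-- to the next around the crossing. It is why a single `ε` serves all four.
Perp-rotate : ∀ ε p q → Perp ε p q → Perp ε q (opp p)
Perp-rotate ε p q (perp n e) = perp n (from-yes (∀turn? λ ε → ∀port? λ p → ∀port? λ q →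
  ¬? (ε ≟ᵗ ahead) →-dec (veer ε (opp q) ≟ᵖ p) →-dec (veer ε (opp (opp p)) ≟ᵖ q)) ε p q n e)

reverse-≢ahead : ∀ {ε} → ε ≢ ahead → reverse ε ≢ ahead
reverse-≢ahead {ahead} n _ = n refl

Perp-opp₁ : ∀ {ε p q} → Perp ε p q → Perp (reverse ε) (opp p) q
Perp-opp₁ {ε} {p} {q} (perp n e) = perp (reverse-≢ahead n) (from-yes
  (∀turn? λ ε → ∀port? λ p → ∀port? λ q → ¬? (ε ≟ᵗ ahead) →-dec
   (veer ε (opp q) ≟ᵖ p) →-dec (veer (reverse ε) (opp q) ≟ᵖ opp p)) ε p q n e)

Perp-opp₂ : ∀ {ε p q} → Perp ε p q → Perp (reverse ε) p (opp q)
Perp-opp₂ {ε} {p} {q} (perp n e) = perp (reverse-≢ahead n) (from-yes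
  (∀turn? λ ε → ∀port? λ p → ∀port? λ q → ¬? (ε ≟ᵗ ahead) →-dec
   (veer ε (opp q) ≟ᵖ p) →-dec (veer (reverse ε) (opp (opp q)) ≟ᵖ p)) ε p q n e)

Ccw : Port → Port → Port → Set
Ccw p q r = (q ≡ veer left p × r ≡ veer left q) ⊎
            (r ≡ veer left q × p ≡ veer left r) ⊎
            (p ≡ veer left r × q ≡ veer left p)

ccw? : ∀ p q r → Dec (Ccw p q r)
ccw? p q r = (q ≟ᵖ veer left p ×-dec r ≟ᵖ veer left q) ⊎-dec
             (r ≟ᵖ veer left q ×-dec p ≟ᵖ veer left r) ⊎-dec
             (p ≟ᵖ veer left r ×-dec q ≟ᵖ veer left p)

Consecutive : Port → Port → Port → Port → Set
Consecutive p q r s = q ≡ veer left p × r ≡ veer left q × s ≡ veer left r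

abstract
  -- Four edges use up the four ports, so neighbouring edges enclose right angles. This is the
  -- effect of degree 4.
  ccw⁴ : ∀ p q r s → Ccw p q r → Ccw p q s → Ccw p r s → Ccw q r s → Consecutive p q r s
  ccw⁴ = from-yes (∀port? λ p → ∀port? λ q → ∀port? λ r → ∀port? λ s →
    ccw? p q r →-dec ccw? p q s →-dec ccw? p r s →-dec ccw? q r s →-dec
    (q ≟ᵖ veer left p ×-dec r ≟ᵖ veer left q ×-dec s ≟ᵖ veer left r))

left-wedge : ∀ {p q} → q ≡ veer left p → veer left (opp q) ≡ p
left-wedge {p} refl = from-yes (∀port? λ p → veer left (opp (veer left p)) ≟ᵖ p) p

-- The turn in the wedge from p counterclockwise to the next port q; right would mean an angle of 270°.
Wedge : Port → Port → Set
Wedge p q = ∃[ τ ] τ ≢ right × veer τ (opp q) ≡ p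

-- Three distinct ports cut the full angle into 90°, 90° and 180° in some order. In the middle
-- alternative the straight angle is this one.
ccw-wedge₁ : ∀ {p q r} → Ccw p q r → Wedge p q
ccw-wedge₁ (inj₁ (e , _))              = left , (λ ()) , left-wedge e
ccw-wedge₁ (inj₂ (inj₁ (refl , refl))) = ahead , (λ ()) , refl
ccw-wedge₁ (inj₂ (inj₂ (_ , e)))       = left , (λ ()) , left-wedge e

ccw-wedge₂ : ∀ {p q r} → Ccw p q r → Wedge q r
ccw-wedge₂ (inj₁ (_ , e))              = left , (λ ()) , left-wedge e
ccw-wedge₂ (inj₂ (inj₁ (e , _)))       = left , (λ ()) , left-wedge e
ccw-wedge₂ (inj₂ (inj₂ (refl , refl))) = ahead , (λ ()) , refl

-- Edges with at most two segments

module Layouts {c ℓ : Level} (K : OrderedField c ℓ) where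
  open Rectilinear K

  private
    unit-vector : ∀ p {A B} → Towards p A B →
      ∃[ s ] 0# < s × x (B ⊖ A) ≡ s * ι (unitˣ p) × y (B ⊖ A) ≡ s * ι (unitʸ p)
    unit-vector north {A} {B} (e , l) = y B - y A , a<b⇒0<b-a l ,
      trans (cong (_- x A) (sym e)) (solve 2 (λ a s → a :- a := s :* con 0ℤ) refl _ _) ,
      solve 1 (λ s → s := s :* con 1ℤ) refl _
    unit-vector south {A} {B} (e , l) = y A - y B , a<b⇒0<b-a l ,
      trans (cong (_- x A) (sym e)) (solve 2 (λ a s → a :- a := s :* con 0ℤ) refl _ _) ,
      solve 2 (λ a b → b :- a := (a :- b) :* con -1ℤ) refl _ _
    unit-vector east {A} {B} (l , e) = x B - x A , a<b⇒0<b-a l ,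
      solve 1 (λ s → s := s :* con 1ℤ) refl _ ,
      trans (cong (_- y A) (sym e)) (solve 2 (λ a s → a :- a := s :* con 0ℤ) refl _ _)
    unit-vector west {A} {B} (l , e) = x A - x B , a<b⇒0<b-a l ,
      solve 2 (λ a b → b :- a := (a :- b) :* con -1ℤ) refl _ _ ,
      trans (cong (_- y A) (sym e)) (solve 2 (λ a s → a :- a := s :* con 0ℤ) refl _ _)

  abstract
    -- Axis-parallel vectors are positive multiples of unit vectors, so the sign of their
    -- determinant depends only on the two ports.
    det-towards : ∀ p q {A B C D} → Towards p A B → Towards q C D →
      ∃[ s ] 0# < s × det (B ⊖ A) (D ⊖ C) ≡ s * ι (unit-det p q)
    det-towards p q {A} {B} {C} {D} t u with unit-vector p t | unit-vector q u
    ... | s , 0<s , xp , yp | r , 0<r , xq , yq = s * r , *-pos 0<s 0<r , (begin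
      det (B ⊖ A) (D ⊖ C)
        ≡⟨ cong₂ _-_ (cong₂ _*_ xp yq) (cong₂ _*_ yp xq) ⟩
      s * ι (unitˣ p) * (r * ι (unitʸ q)) - s * ι (unitʸ p) * (r * ι (unitˣ q))
        ≡⟨ solve 6 (λ s r a b c d → s :* a :* (r :* b) :- s :* c :* (r :* d)
                      := s :* r :* (a :* b :- c :* d)) refl s r _ _ _ _ ⟩
      s * r * (ι (unitˣ p) * ι (unitʸ q) - ι (unitʸ p) * ι (unitˣ q))
        ≡⟨ cong (s * r *_) (ι-det (unitˣ p) (unitʸ q) (unitʸ p) (unitˣ q)) ⟨
      s * r * ι (unit-det p q) ∎)
      where open ≡-Reasoning

  det-left : ∀ p q {A B C D} → Towards p A B → Towards q C D →
             0# < det (B ⊖ A) (D ⊖ C) → q ≡ veer left p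
  det-left p q t u 0<det with det-towards p q t u
  ... | s , 0<s , e =
    unit-det-left p q (ι-cancel-< (*-cancel-pos 0<s (<-respʳ 0<det e)))

  det-perp : ∀ p q {A B C D} → Towards p A B → Towards q C D →
             det (B ⊖ A) (D ⊖ C) ≢ 0# → ∃[ ε ] Perp ε p q
  det-perp p q t u det≢0 with det-towards p q t u
  ... | s , _ , e = unit-det-perp p q λ 0≡ → det≢0 (trans e (trans (cong (λ i → s * ι i) 0≡) (zeroʳ s)))

  ccw-ports : ∀ p q r {A B C D E F} → Towards p A B → Towards q C D → Towards r E F →
    Counterclockwise (B ⊖ A) (D ⊖ C) (F ⊖ E) → Ccw p q r
  ccw-ports p q r t u v (inj₁ (a , b))        = inj₁ (det-left p q t u a , det-left q r u v b)
  ccw-ports p q r t u v (inj₂ (inj₁ (b , e))) = inj₂ (inj₁ (det-left q r u v b , det-left r p v t e))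
  ccw-ports p q r t u v (inj₂ (inj₂ (e , a))) = inj₂ (inj₂ (det-left r p v t e , det-left p q t u a))

  along⇒on : ∀ p {A B r} → Along p A B r → r on (A , B)
  along⇒on north {A} {B} {r} ((refl , l) , (refl , m)) =
    solve 4 (λ a b c d → (a :- a) :* (c :- b) :- (d :- b) :* (a :- a) := con 0ℤ) refl (x A) (y A) (y r) (y B) ,
    inj₁ (inj₂ refl , inj₂ refl) , inj₁ (inj₁ l , inj₁ m)
  along⇒on south {A} {B} {r} ((refl , l) , (refl , m)) =
    solve 4 (λ a b c d → (a :- a) :* (c :- b) :- (d :- b) :* (a :- a) := con 0ℤ) refl (x A) (y A) (y r) (y B) ,
    inj₁ (inj₂ refl , inj₂ refl) , inj₂ (inj₁ m , inj₁ l)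
  along⇒on east {A} {B} {r} ((l , refl) , (m , refl)) =
    solve 4 (λ a b c d → (d :- a) :* (b :- b) :- (b :- b) :* (c :- a) := con 0ℤ) refl (x A) (y A) (x r) (x B) ,
    inj₁ (inj₁ l , inj₁ m) , inj₁ (inj₂ refl , inj₂ refl)
  along⇒on west {A} {B} {r} ((l , refl) , (m , refl)) =
    solve 4 (λ a b c d → (d :- a) :* (b :- b) :- (b :- b) :* (c :- a) := con 0ℤ) refl (x A) (y A) (x r) (x B) ,
    inj₂ (inj₁ m , inj₁ l) , inj₁ (inj₂ refl , inj₂ refl)

  private
    between≡ : ∀ {a b t} → a ≡ b → Between a b t → t ≡ a
    between≡ refl (inj₁ (p , q)) = ≤-antisym q p
    between≡ refl (inj₂ (p , q)) = ≤-antisym q p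

    between< : ∀ {a b t} → a < b → Between a b t → a ≤ t × t ≤ b
    between< a<b (inj₁ p)       = p
    between< a<b (inj₂ (p , q)) = contradiction a<b (≤⇒≯ (≤-trans p q))

    between> : ∀ {a b t} → b < a → Between a b t → b ≤ t × t ≤ a
    between> b<a (inj₂ p)       = p
    between> b<a (inj₁ (p , q)) = contradiction b<a (≤⇒≯ (≤-trans p q))

  inside⇒along : ∀ p {A B r} → Towards p A B → r inside (A , B) → Along p A B r
  inside⇒along north (e , l) ((_ , bx , by) , r≢A , r≢B) with between≡ e bx | between< l by
  ... | e′ | a , b = (sym e′ , ≤∧≢⇒< a λ q → r≢A (cong₂ ⟨_,_⟩ e′ (sym q))) ,
                     (trans e′ e , ≤∧≢⇒< b λ q → r≢B (cong₂ ⟨_,_⟩ (trans e′ e) q))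
  inside⇒along south (e , l) ((_ , bx , by) , r≢A , r≢B) with between≡ e bx | between> l by
  ... | e′ | b , a = (sym e′ , ≤∧≢⇒< a λ q → r≢A (cong₂ ⟨_,_⟩ e′ q)) ,
                     (trans e′ e , ≤∧≢⇒< b λ q → r≢B (cong₂ ⟨_,_⟩ (trans e′ e) (sym q)))
  inside⇒along east (l , e) ((_ , bx , by) , r≢A , r≢B) with between≡ e by | between< l bx
  ... | e′ | a , b = (≤∧≢⇒< a (λ q → r≢A (cong₂ ⟨_,_⟩ (sym q) e′)) , sym e′) ,
                     (≤∧≢⇒< b (λ q → r≢B (cong₂ ⟨_,_⟩ q (trans e′ e))) , trans e′ e)
  inside⇒along west (l , e) ((_ , bx , by) , r≢A , r≢B) with between≡ e by | between> l bx
  ... | e′ | b , a = (≤∧≢⇒< a (λ q → r≢A (cong₂ ⟨_,_⟩ q e′)) , sym e′) ,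
                     (≤∧≢⇒< b (λ q → r≢B (cong₂ ⟨_,_⟩ (sym q) (trans e′ e))) , trans e′ e)

  horizontal-port : ∀ {A B} → A ≢ B → Horizontal (A , B) → Towards east A B ⊎ Towards west A B
  horizontal-port {A} {B} A≢B e with compare (x A) (x B)
  ... | tri< l _ _ = inj₁ (l , e)
  ... | tri≈ _ f _ = contradiction (cong₂ ⟨_,_⟩ f e) A≢B
  ... | tri> _ _ l = inj₂ (l , e)

  vertical-port : ∀ {A B} → A ≢ B → Vertical (A , B) → Towards north A B ⊎ Towards south A B
  vertical-port {A} {B} A≢B e with compare (y A) (y B)
  ... | tri< l _ _ = inj₁ (e , l)
  ... | tri≈ _ f _ = contradiction (cong₂ ⟨_,_⟩ e f) A≢B
  ... | tri> _ _ l = inj₂ (e , l)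

  data Shape (A B : Point) : List Point → Set (c ⊔ ℓ) where
    straight : ∀ p → Towards p A B → Shape A B []
    bent     : ∀ p t {b} → Towards p A b → Towards (veer t p) b B → Shape A B (b ∷ [])

  shape : ∀ A B bs → SimplePath (A ∷ bs ++ B ∷ []) →
    All AxisParallel (segments (A ∷ bs ++ B ∷ [])) →
    Linked Perpendicular (segments (A ∷ bs ++ B ∷ [])) →
    length (segments (A ∷ bs ++ B ∷ [])) ℕ.≤ 2 → Shape A B bs
  shape A B [] (A≢B , _) (inj₁ h ∷ _) _ _ with horizontal-port A≢B h
  ... | inj₁ t = straight east t
  ... | inj₂ t = straight west t
  shape A B [] (A≢B , _) (inj₂ v ∷ _) _ _ with vertical-port A≢B v
  ... | inj₁ t = straight north t
  ... | inj₂ t = straight south t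
  shape A B (b ∷ []) (A≢b , _ , b≢B , _) _ (inj₁ (h , v) ∷ _) _
    with horizontal-port A≢b h | vertical-port b≢B v
  ... | inj₁ s | inj₁ t = bent east left s t
  ... | inj₁ s | inj₂ t = bent east right s t
  ... | inj₂ s | inj₁ t = bent west right s t
  ... | inj₂ s | inj₂ t = bent west left s t
  shape A B (b ∷ []) (A≢b , _ , b≢B , _) _ (inj₂ (v , h) ∷ _) _
    with vertical-port A≢b v | horizontal-port b≢B h
  ... | inj₁ s | inj₁ t = bent north right s t
  ... | inj₁ s | inj₂ t = bent north left s t
  ... | inj₂ s | inj₁ t = bent south left s t
  ... | inj₂ s | inj₂ t = bent south right s t
  shape A B (b ∷ b′ ∷ [])     _ _ _ (s≤s (s≤s ()))
  shape A B (b ∷ b′ ∷ _ ∷ _)  _ _ _ (s≤s (s≤s ()))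

  departure arrival : ∀ {A B bs} → Shape A B bs → Port
  departure (straight p _) = p
  departure (bent p _ _ _) = p
  arrival   (straight p _) = p
  arrival   (bent p t _ _) = veer t p

  On : Point → List Point → Point → Point → Set (c ⊔ ℓ)
  On A bs B r = r onPath (A ∷ bs ++ B ∷ [])

  shape-turn : ∀ {A B bs} → Shape A B bs → Turn
  shape-turn (straight _ _) = ahead
  shape-turn (bent _ t _ _) = t

  shape-route : ∀ {A B bs} (σ : Shape A B bs) →
    Route A B (departure σ) (shape-turn σ) (arrival σ) (On A bs B)
  shape-route (straight p AB) = straight-route p AB (here ∘ along⇒on p)
  shape-route (bent p t {b} Ab bB) = record
    { corner = b ; turning = refl ; depart = Ab ; arrive = bB
    ; departing = here ∘ along⇒on p ; arriving = there ∘ here ∘ along⇒on (veer t p) }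

  -- An edge from `A` to `B` cut at an interior point `X` of its segment `s`, both halves being read
  -- outward from `X`. As `X` is not the bend, the only bend lies on one of the halves and the other
  -- is straight.
  record Halves (X A B : Point) (p q : Port) (S : Point → Set (c ⊔ ℓ)) (s : Segment) : Set (c ⊔ ℓ) where
    field
      π        : Port
      t t′     : Turn
      back     : Route X A (opp π) t (opp p) S
      forth    : Route X B π t′ q S
      one-bend : t ≡ ahead ⊎ t′ ≡ ahead
      segment  : Towards π (proj₁ s) (proj₂ s)

  private
    behind : ∀ p {A X r} → Along (opp p) X A r → Along p A X r
    behind p (u , v) = Towards-unopp p v , Towards-unopp p u

    extend-back : ∀ p {A B X r} → Towards p X B → Along p A X r → Along p A B r
    extend-back p XB (Ar , rX) = Ar , Towards-trans p rX XB

    extend-forth : ∀ p {A B X r} → Towards p A X → Along p X B r → Along p A B r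
    extend-forth p AX (Xr , rB) = Towards-trans p AX Xr , rB

  shape-halves : ∀ {A B bs X s} (σ : Shape A B bs) → s ∈ segments (A ∷ bs ++ B ∷ []) → X inside s →
    Halves X A B (departure σ) (arrival σ) (On A bs B) s
  shape-halves (straight p AB) (here refl) X with inside⇒along p AB X
  ... | AX , XB = record
    { π = p ; t = ahead ; t′ = ahead ; segment = AB ; one-bend = inj₁ refl
    ; back  = straight-route (opp p) (Towards-opp p AX) (here ∘ along⇒on p ∘ extend-back p XB ∘ behind p)
    ; forth = straight-route p XB (here ∘ along⇒on p ∘ extend-forth p AX) }
  shape-halves (bent p t {b} Ab bB) (here refl) X with inside⇒along p Ab X
  ... | AX , Xb = record
    { π = p ; t = ahead ; t′ = t ; segment = Ab ; one-bend = inj₁ refl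
    ; back  = straight-route (opp p) (Towards-opp p AX) (here ∘ along⇒on p ∘ extend-back p Xb ∘ behind p)
    ; forth = record
      { corner = b ; turning = refl ; depart = Xb ; arrive = bB
      ; departing = here ∘ along⇒on p ∘ extend-forth p AX
      ; arriving = there ∘ here ∘ along⇒on (veer t p) } }
  shape-halves (bent p t {b} Ab bB) (there (here refl)) X with inside⇒along (veer t p) bB X
  ... | bX , XB = record
    { π = q ; t = reverse t ; t′ = ahead ; segment = bB ; one-bend = inj₂ refl
    ; back  = record
      { corner = b ; turning = veer-reverse t p
      ; depart = Towards-opp q bX ; arrive = Towards-opp p Ab
      ; departing = there ∘ here ∘ along⇒on q ∘ extend-back q XB ∘ behind q
      ; arriving = here ∘ along⇒on p ∘ behind p }
    ; forth = straight-route q XB (there ∘ here ∘ along⇒on q ∘ extend-forth q bX) }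
    where q = veer t p

-- Kites in an orthogonal layout

module OrthogonalLayout {c ℓ : Level} {K : OrderedField c ℓ} {G : Graph} {E : Embedding G}
  (D : Drawing K G) (onePlanar : OnePlanar K G D) (realizes : Realizes K G D E)
  (orthogonal : Orthogonal K G D) (oneBend : CurveComplexity≤ K G D 2) where
  open Graph G
  open Drawing D
  open Rectilinear K
  open Layouts K
  open Realizes realizes
  open Orthogonal orthogonal
  open Embedding E

  edge-shape : ∀ e → Shape (pos (src e)) (pos (tgt e)) (bends e)
  edge-shape e = shape _ _ (bends e) (path-simple e) (axisParallel e) (turns e) (oneBend e)

  port : Dart → Port
  port (fwd e) = departure (edge-shape e)
  port (bwd e) = opp (arrival (edge-shape e))

  bend : Edge → Turn
  bend e = shape-turn (edge-shape e)

  towards-next : ∀ d → Towards (port d) (pos (tail d)) (next d)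
  towards-next (fwd e) = first (edge-shape e)
    where
    first : ∀ {A B bs} (σ : Shape A B bs) → Towards (departure σ) A (fromMaybe B (head bs))
    first (straight _ AB) = AB
    first (bent _ _ Ab _) = Ab
  towards-next (bwd e) = final (edge-shape e)
    where
    final : ∀ {A B bs} (σ : Shape A B bs) → Towards (opp (arrival σ)) B (fromMaybe A (last bs))
    final (straight p AB)   = Towards-opp p AB
    final (bent p t _ bB) = Towards-opp (veer t p) bB

  edge-route : ∀ e {u v} → src e ≡ u → tgt e ≡ v →
    Route (pos u) (pos v) (port (fwd e)) (bend e) (opp (port (bwd e))) (_onPath path e)
  edge-route e refl refl =
    subst (λ q → Route (pos (src e)) (pos (tgt e)) (port (fwd e)) (bend e) q (_onPath path e))
      (sym (opp-opp _)) (shape-route (edge-shape e))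

  rotation-ccw : ∀ v {d d′ d″} → d ∷ d′ ∷ d″ ∷ [] ⊆ rotation v → Ccw (port d) (port d′) (port d″)
  rotation-ccw v {d} {d′} {d″} i = ccw-ports (port d) (port d′) (port d″)
    (towards-next d) (towards-next d′) (towards-next d″) (rotations v i)

  rotation³ : ∀ v {d₁ d₂ d₃} → rotation v ≡ d₁ ∷ d₂ ∷ d₃ ∷ [] → Ccw (port d₁) (port d₂) (port d₃)
  rotation³ v {d₁} {d₂} {d₃} r = rotation-ccw v {d₁} {d₂} {d₃}
    (subst (d₁ ∷ d₂ ∷ d₃ ∷ [] ⊆_) (sym r) (refl ∷ refl ∷ refl ∷ []))

  rotation⁴ : ∀ v {d₁ d₂ d₃ d₄} → rotation v ≡ d₁ ∷ d₂ ∷ d₃ ∷ d₄ ∷ [] →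
    Consecutive (port d₁) (port d₂) (port d₃) (port d₄)
  rotation⁴ v {d₁} {d₂} {d₃} {d₄} r = ccw⁴ (port d₁) (port d₂) (port d₃) (port d₄)
    (ccw d₁ d₂ d₃ (refl ∷ refl ∷ refl ∷ d₄ ∷ʳ []))
    (ccw d₁ d₂ d₄ (refl ∷ refl ∷ d₃ ∷ʳ refl ∷ []))
    (ccw d₁ d₃ d₄ (refl ∷ d₂ ∷ʳ refl ∷ refl ∷ []))
    (ccw d₂ d₃ d₄ (d₁ ∷ʳ refl ∷ refl ∷ refl ∷ []))
    where
    ccw : ∀ d d′ d″ → d ∷ d′ ∷ d″ ∷ [] ⊆ d₁ ∷ d₂ ∷ d₃ ∷ d₄ ∷ [] →
          Ccw (port d) (port d′) (port d″)
    ccw d d′ d″ i = rotation-ccw v {d} {d′} {d″} (subst (d ∷ d′ ∷ d″ ∷ [] ⊆_) (sym r) i)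

  private
    is-vertex? : ∀ r → Dec (∃[ v ] r ≡ pos v)
    is-vertex? r = Fin.any? (λ v → r ≟ᴾ pos v)

    ends : ∀ {e v w} → Incident v e → Incident w e → v ≢ w →
           (src e ≡ v × tgt e ≡ w) ⊎ (src e ≡ w × tgt e ≡ v)
    ends (inj₁ p) (inj₁ q) v≢w = contradiction (trans p (sym q)) v≢w
    ends (inj₁ p) (inj₂ q) _   = inj₁ (sym p , sym q)
    ends (inj₂ p) (inj₁ q) _   = inj₂ (sym q , sym p)
    ends (inj₂ p) (inj₂ q) v≢w = contradiction (trans p (sym q)) v≢w

  simple-ends : ∀ {e f v w} → Incident v e → Incident w e → Incident v f → Incident w f → v ≢ w → e ≡ f
  simple-ends {e} {f} ve we vf wf v≢w with ends ve we v≢w | ends vf wf v≢w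
  ... | inj₁ (p , q) | inj₁ (p′ , q′) = simple e f (inj₁ (trans p (sym p′) , trans q (sym q′)))
  ... | inj₁ (p , q) | inj₂ (p′ , q′) = simple e f (inj₂ (trans p (sym q′) , trans q (sym p′)))
  ... | inj₂ (p , q) | inj₁ (p′ , q′) = simple e f (inj₂ (trans p (sym q′) , trans q (sym p′)))
  ... | inj₂ (p , q) | inj₂ (p′ , q′) = simple e f (inj₁ (trans p (sym p′) , trans q (sym q′)))

  -- A common point that is no vertex would be a crossing of adjacent edges, and a second common
  -- vertex would make the edges parallel.
  meet-at-vertex : ∀ {e f w r} → e ≢ f → Incident w e → Incident w f →
    r onPath path e → r onPath path f → r ≡ pos w
  meet-at-vertex {e} {f} {w} {r} e≢f we wf re rf with is-vertex? r
  ... | no ¬v = contradiction (e≢f , re , rf , λ v r≡v → ¬v (v , r≡v)) (adjacent we wf)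
  ... | yes (v , refl) with v Fin.≟ w
  ...   | yes refl = refl
  ...   | no v≢w   = contradiction (simple-ends (avoids e v re) we (avoids f v rf) wf v≢w) e≢f

  -- Crossing edges have no common end, and 1-planarity leaves them only one crossing point.
  meet-at-crossing : ∀ {e f X r} → CrossAt e f X → r onPath path e → r onPath path f → r ≡ X
  meet-at-crossing {e} {f} {X} {r} ef@(e≢f , _) re rf with is-vertex? r
  ... | yes (v , refl) = contradiction ef (adjacent (avoids e v re) (avoids f v rf))
  ... | no ¬v = proj₂ (onePlanar e f f r X (e≢f , re , rf , λ v r≡v → ¬v (v , r≡v)) ef)

  record Spoke (X : Point) (v : Vertex) (p : Port) (e : Edge) : Set (c ⊔ ℓ) where
    field
      {π}   : Port
      {t}   : Turn
      route : Route X (pos v) π t (opp p) (_onPath path e)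

  -- The half-edges lie around `X` in the cyclic order `e⁻`, `f⁻`, `e⁺`, `f⁺`, clockwise or
  -- counterclockwise; `ε` tells which.
  record Cross (X : Point) (e f : Edge) : Set (c ⊔ ℓ) where
    field
      crossAt  : CrossAt e f X
      e⁻       : Spoke X (src e) (port (fwd e)) e
      e⁺       : Spoke X (tgt e) (port (bwd e)) e
      f⁻       : Spoke X (src f) (port (fwd f)) f
      f⁺       : Spoke X (tgt f) (port (bwd f)) f
      ε        : Turn
      e⁻f⁻     : Perp ε (Spoke.π e⁻) (Spoke.π f⁻)
      f⁻e⁺     : Perp ε (Spoke.π f⁻) (Spoke.π e⁺)
      e⁺f⁺     : Perp ε (Spoke.π e⁺) (Spoke.π f⁺)
      f⁺e⁻     : Perp ε (Spoke.π f⁺) (Spoke.π e⁻)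
      one-bend : Spoke.t e⁻ ≡ ahead ⊎ Spoke.t e⁺ ≡ ahead

  cross : ∀ {e f} → crossing e ≡ just f → ∃[ X ] Cross X e f
  cross {e} {f} c with Equivalence.to (crossings e f) c
  ... | X , ef with transversal ef
  ... | s , t , s∈e , t∈f , Xs , Xt , det≢0 = X , record
    { crossAt = ef
    ; e⁻ = record { route = back (edge-shape e) e⁄ }
    ; e⁺ = record { route = forth′ e⁄ }
    ; f⁻ = record { route = back (edge-shape f) f⁄ }
    ; f⁺ = record { route = forth′ f⁄ }
    ; ε = ε
    ; e⁻f⁻ = e⁻f⁻
    ; f⁻e⁺ = f⁻e⁺
    ; e⁺f⁺ = e⁺f⁺
    ; f⁺e⁻ = Perp-rotate ε (H.π e⁄) (H.π f⁄) e⁺f⁺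
    ; one-bend = H.one-bend e⁄
    }
    where
    module H = Halves
    e⁄ = shape-halves (edge-shape e) s∈e Xs
    f⁄ = shape-halves (edge-shape f) t∈f Xt
    back : ∀ {A B bs s} (σ : Shape A B bs) (h : Halves X A B (departure σ) (arrival σ) (On A bs B) s) → _
    back _ = H.back
    forth′ : ∀ {A B p q S s} (h : Halves X A B p q S s) → Route X B (H.π h) (H.t′ h) (opp (opp q)) S
    forth′ {A} {B} {S = S} h = subst (λ q → Route X B _ _ q S) (sym (opp-opp _)) (H.forth h)
    e⊥f = det-perp (H.π e⁄) (H.π f⁄) (H.segment e⁄) (H.segment f⁄) det≢0
    -- `e⊥f` speaks of the directions in which the edges run, that is of `e⁺` and `f⁺`. Passing to
    -- `e⁻` and `f⁻` reverses the turn twice, and the value is kept in the form in which `e⁻f⁻`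
    -- delivers it.
    ε = reverse (reverse (proj₁ e⊥f))
    e⁻f⁻ : Perp ε (opp (H.π e⁄)) (opp (H.π f⁄))
    e⁻f⁻ = Perp-opp₁ (Perp-opp₂ (proj₂ e⊥f))
    f⁻e⁺ : Perp ε (opp (H.π f⁄)) (H.π e⁄)
    f⁻e⁺ = subst (Perp ε _) (opp-opp _) (Perp-rotate ε _ _ e⁻f⁻)
    e⁺f⁺ : Perp ε (H.π e⁄) (H.π f⁄)
    e⁺f⁺ = subst (Perp ε _) (opp-opp _) (Perp-rotate ε _ _ f⁻e⁺)

  kite-turns : ∀ {X e f g u v p q p′ q′ t ε σ τ} → CrossAt e f X →
    (s : Spoke X u p e) → Route (pos u) (pos v) p′ t (opp q′) (_onPath path g) → (s′ : Spoke X v q f) →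
    Incident u e → Incident v f → Incident u g → Incident v g →
    veer σ (opp p) ≡ p′ → veer τ (opp q′) ≡ q → Perp ε (Spoke.π s) (Spoke.π s′) →
    Around (Spoke.t s ∷ σ ∷ t ∷ τ ∷ reverse (Spoke.t s′) ∷ ε ∷ [])
  kite-turns {ε = ε} {σ} {τ} ef s g s′ ue vf ug vg σ≡ τ≡ (perp _ ε≡) =
    kite {s₁ = σ} {τ} {ε} (Spoke.route s) σ≡ g τ≡ (backwards (Spoke.route s′)) ε≡
      -- If `g` were `e` or `f`, the two crossing edges would have a common end.
      (meet-at-vertex (λ { refl → adjacent vg vf ef }) ue ug)
      (meet-at-vertex (λ { refl → adjacent ue ug ef }) vg vf)
      (λ rf re → meet-at-crossing ef re rf)

  -- A K₄ on a, b, c, d with crossing diagonals, whose edge ab is separated from the outer face by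
  -- the crossing Y of two further edges e and f that start at b and a.
  half-edge-bent : ∀ {ac bd ab bc cd da X Y e f p q δ} → Cross X ac bd →
    src ab ≡ src ac → tgt ab ≡ src bd → src bc ≡ src bd → tgt bc ≡ tgt ac →
    src cd ≡ tgt ac → tgt cd ≡ tgt bd → src da ≡ tgt bd → tgt da ≡ src ac →
    CrossAt e f Y → Incident (src bd) e → Incident (src ac) f →
    (s : Spoke Y (src bd) p e) (s′ : Spoke Y (src ac) q f) → Perp δ (Spoke.π s) (Spoke.π s′) →
    Consecutive q (port (fwd ab)) (port (fwd ac)) (port (bwd da)) →
    Consecutive (port (fwd bc)) (port (fwd bd)) (port (bwd ab)) p →
    Ccw (port (fwd cd)) (port (bwd ac)) (port (bwd bc)) →
    Ccw (port (fwd da)) (port (bwd bd)) (port (bwd cd)) →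
    Spoke.t s ≡ left
  half-edge-bent {ac} {bd} {ab} {bc} {cd} {da} {X} {δ = δ} X⊗
    ab⁻ ab⁺ bc⁻ bc⁺ cd⁻ cd⁺ da⁻ da⁺ ef be af s s′ Y⊥ (a₁ , a₂ , a₃) (b₁ , b₂ , b₃) c d
    with ccw-wedge₁ c | ccw-wedge₂ c | ccw-wedge₁ d | ccw-wedge₂ d
  ... | σᶜ , σᶜ≢right , σᶜ≡ | τᶜ , τᶜ≢right , τᶜ≡ | σᵈ , σᵈ≢right , σᵈ≡ | τᵈ , τᵈ≢right , τᵈ≡ =
    half-edge-bends {δ = δ} {hᵃ = Spoke.t e⁻} {Spoke.t f⁻} {Spoke.t e⁺} {Spoke.t f⁺}
      {bend ab} {bend bc} {bend cd} {bend da} {Spoke.t s′} (Perp.ε≢ahead e⁻f⁻)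
      τᶜ≢right σᶜ≢right τᵈ≢right σᵈ≢right
      (kite-turns {q′ = port (bwd ab)} {σ = left} {left} crossAt e⁻ (edge-route ab ab⁻ ab⁺) f⁻
        (inj₁ refl) (inj₁ refl)
        (inj₁ (sym ab⁻)) (inj₂ (sym ab⁺)) (left-wedge a₂) (left-wedge b₂) e⁻f⁻)
      (kite-turns {q′ = port (bwd bc)} {σ = left} {τᶜ} fe f⁻ (edge-route bc bc⁻ bc⁺) e⁺
        (inj₁ refl) (inj₂ refl)
        (inj₁ (sym bc⁻)) (inj₂ (sym bc⁺)) (left-wedge b₁) τᶜ≡ f⁻e⁺)
      (kite-turns {q′ = port (bwd cd)} {σ = σᶜ} {τᵈ} crossAt e⁺ (edge-route cd cd⁻ cd⁺) f⁺
        (inj₂ refl) (inj₂ refl)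
        (inj₁ (sym cd⁻)) (inj₂ (sym cd⁺)) σᶜ≡ τᵈ≡ e⁺f⁺)
      (kite-turns {q′ = port (bwd da)} {σ = σᵈ} {left} fe f⁺ (edge-route da da⁻ da⁺) e⁻
        (inj₂ refl) (inj₁ refl)
        (inj₁ (sym da⁻)) (inj₂ (sym da⁺)) σᵈ≡ (left-wedge a₃) f⁺e⁻)
      -- The kite at `Y` lies on the other side of `ab` and traverses it from b to a, so the bend of
      -- `ab` enters reversed.
      (kite-turns {p′ = port (bwd ab)} {q′ = port (fwd ab)} {σ = left} {left} ef s
        (backwards (edge-route ab ab⁻ ab⁺)) s′ be af
        (inj₂ (sym ab⁺)) (inj₁ (sym ab⁻)) (left-wedge b₃) (left-wedge a₁) Y⊥)
    where
    open Cross X⊗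
    fe : CrossAt bd ac X
    fe with crossAt
    ... | e≢f , re , rf , ¬v = e≢f ∘ sym , rf , re , ¬v

-- Lattice segments and straight-line drawings

Lattice : Set
Lattice = ℤ × ℤ

LatticeSegment : Set
LatticeSegment = Lattice × Lattice

_≟ᶻ_ : DecidableEquality Lattice
_≟ᶻ_ = Product.≡-dec ℤ._≟_ ℤ._≟_

infixl 6 _⊖ᶻ_
_⊖ᶻ_ : Lattice → Lattice → Lattice
(a , b) ⊖ᶻ (c , d) = a ℤ.- c , b ℤ.- d

detᶻ : Lattice → Lattice → ℤ
detᶻ (a , b) (c , d) = a ℤ.* d ℤ.- b ℤ.* c

Collinear : Lattice → LatticeSegment → Set
Collinear M (P , Q) = detᶻ (Q ⊖ᶻ P) (M ⊖ᶻ P) ≡ 0ℤ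

Betweenᶻ : ℤ → ℤ → ℤ → Set
Betweenᶻ a b t = (a ℤ.≤ t × t ℤ.≤ b) ⊎ (b ℤ.≤ t × t ℤ.≤ a)

infix 4 _onᶻ_
_onᶻ_ : Lattice → LatticeSegment → Set
M@(a , b) onᶻ s@((c , d) , (c′ , d′)) = Collinear M s × Betweenᶻ c c′ a × Betweenᶻ d d′ b

_insideᶻ_ : Lattice → LatticeSegment → Set
M insideᶻ s@(P , Q) = M onᶻ s × M ≢ P × M ≢ Q

Below : (a b c d : ℤ) → Set
Below a b c d = a ℤ.< c × a ℤ.< d × b ℤ.< c × b ℤ.< d

BoxesDisjoint : LatticeSegment → LatticeSegment → Set
BoxesDisjoint ((a , a′) , (b , b′)) ((c , c′) , (d , d′)) =
  (Below a b c d ⊎ Below c d a b) ⊎ (Below a′ b′ c′ d′ ⊎ Below c′ d′ a′ b′)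

MeetOnlyAt : Lattice → LatticeSegment → LatticeSegment → Set
MeetOnlyAt M s@(P , Q) t@(P′ , Q′) =
  Collinear M s × Collinear M t × detᶻ (Q ⊖ᶻ P) (Q′ ⊖ᶻ P′) ≢ 0ℤ

-- The common point of two lines by Cramer's rule; a junk value if they are parallel or if the
-- common point is not a lattice point.
cramer : LatticeSegment → LatticeSegment → Lattice
cramer (P@(a , b) , Q) (P′ , Q′) =
  a ℤ.+ quot (proj₁ u ℤ.* num) den , b ℤ.+ quot (proj₂ u ℤ.* num) den
  where
  u   = Q ⊖ᶻ P
  v   = Q′ ⊖ᶻ P′
  num = detᶻ (P′ ⊖ᶻ P) v
  den = detᶻ u v
  quot : ℤ → ℤ → ℤ
  quot i (nat zero)    = 0ℤ
  quot i (nat (suc k)) = i ℤ./ℕ suc k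
  quot i -[1+ k ]      = (ℤ.- i) ℤ./ℕ suc k

-- Two certificates: separated bounding boxes, which also handle parallel segments, or a lattice
-- point that is the only common point of the two lines and misses one of the segments.
Disjointᶻ : LatticeSegment → LatticeSegment → Set
Disjointᶻ s t = BoxesDisjoint s t ⊎ MeetOnlyAt (cramer s t) s t × (¬ cramer s t onᶻ s ⊎ ¬ cramer s t onᶻ t)

collinear? : ∀ M s → Dec (Collinear M s)
collinear? M (P , Q) = detᶻ (Q ⊖ᶻ P) (M ⊖ᶻ P) ℤ.≟ 0ℤ

betweenᶻ? : ∀ a b t → Dec (Betweenᶻ a b t)
betweenᶻ? a b t = (a ℤ.≤? t ×-dec t ℤ.≤? b) ⊎-dec (b ℤ.≤? t ×-dec t ℤ.≤? a)

_onᶻ?_ : ∀ M s → Dec (M onᶻ s)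
M@(a , b) onᶻ? s@((c , d) , (c′ , d′)) = collinear? M s ×-dec betweenᶻ? c c′ a ×-dec betweenᶻ? d d′ b

_insideᶻ?_ : ∀ M s → Dec (M insideᶻ s)
M insideᶻ? s@(P , Q) = M onᶻ? s ×-dec ¬? (M ≟ᶻ P) ×-dec ¬? (M ≟ᶻ Q)

below? : ∀ a b c d → Dec (Below a b c d)
below? a b c d = a ℤ.<? c ×-dec a ℤ.<? d ×-dec b ℤ.<? c ×-dec b ℤ.<? d

boxesDisjoint? : ∀ s t → Dec (BoxesDisjoint s t)
boxesDisjoint? ((a , a′) , (b , b′)) ((c , c′) , (d , d′)) =
  (below? a b c d ⊎-dec below? c d a b) ⊎-dec (below? a′ b′ c′ d′ ⊎-dec below? c′ d′ a′ b′)

meetOnlyAt? : ∀ M s t → Dec (MeetOnlyAt M s t)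
meetOnlyAt? M s@(P , Q) t@(P′ , Q′) =
  collinear? M s ×-dec collinear? M t ×-dec ¬? (detᶻ (Q ⊖ᶻ P) (Q′ ⊖ᶻ P′) ℤ.≟ 0ℤ)

disjointᶻ? : ∀ s t → Dec (Disjointᶻ s t)
disjointᶻ? s t = boxesDisjoint? s t ⊎-dec
  meetOnlyAt? (cramer s t) s t ×-dec (¬? (cramer s t onᶻ? s) ⊎-dec ¬? (cramer s t onᶻ? t))

Aligned : Lattice → Lattice → Set
Aligned (a , b) (c , d) = b ≡ d ⊎ a ≡ c

aligned? : ∀ P Q → Dec (Aligned P Q)
aligned? (a , b) (c , d) = (b ℤ.≟ d) ⊎-dec (a ℤ.≟ c)

MeetAtMostAt : Lattice → LatticeSegment → LatticeSegment → Set
MeetAtMostAt M s t = Disjointᶻ s t ⊎ MeetOnlyAt M s t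

meetAtMostAt? : ∀ M s t → Dec (MeetAtMostAt M s t)
meetAtMostAt? M s t = disjointᶻ? s t ⊎-dec meetOnlyAt? M s t

-- The horizontal ray from P to the right misses s.
MissedByRay : Lattice → LatticeSegment → Set
MissedByRay (a , b) ((c , c′) , (d , d′)) =
  (c ℤ.< a × d ℤ.< a) ⊎ (c′ ℤ.< b × d′ ℤ.< b) ⊎ (b ℤ.< c′ × b ℤ.< d′)

missedByRay? : ∀ P s → Dec (MissedByRay P s)
missedByRay? (a , b) ((c , c′) , (d , d′)) =
  (c ℤ.<? a ×-dec d ℤ.<? a) ⊎-dec (c′ ℤ.<? b ×-dec d′ ℤ.<? b) ⊎-dec (b ℤ.<? c′ ×-dec b ℤ.<? d′)

-- From lattice geometry to an ordered field

module LatticePoints {c ℓ : Level} (K : OrderedField c ℓ) where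
  open Points K

  embed : Lattice → Point
  embed (a , b) = ⟨ ι a , ι b ⟩

  embedˢ : LatticeSegment → Segment
  embedˢ (P , Q) = embed P , embed Q

  embed-injective : ∀ {P Q} → embed P ≡ embed Q → P ≡ Q
  embed-injective e = cong₂ _,_ (ι-injective (cong x e)) (ι-injective (cong y e))

  embed-det : ∀ P Q P′ Q′ →
    det (embed Q ⊖ embed P) (embed Q′ ⊖ embed P′) ≡ ι (detᶻ (Q ⊖ᶻ P) (Q′ ⊖ᶻ P′))
  embed-det (a , b) (c , d) (a′ , b′) (c′ , d′) = sym (trans
    (ι-det (c ℤ.- a) (d′ ℤ.- b′) (d ℤ.- b) (c′ ℤ.- a′))
    (cong₂ _-_ (cong₂ _*_ (ι-minus c a) (ι-minus d′ b′)) (cong₂ _*_ (ι-minus d b) (ι-minus c′ a′))))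

  embed-between : ∀ {a b t} → Betweenᶻ a b t → Between (ι a) (ι b) (ι t)
  embed-between (inj₁ (p , q)) = inj₁ (ι-mono-≤ p , ι-mono-≤ q)
  embed-between (inj₂ (p , q)) = inj₂ (ι-mono-≤ p , ι-mono-≤ q)

  embed-on : ∀ M s → M onᶻ s → embed M on embedˢ s
  embed-on M (P , Q) (d , bx , by) =
    trans (embed-det P Q P M) (cong ι d) , embed-between bx , embed-between by

  embed-inside : ∀ M s → M insideᶻ s → embed M inside embedˢ s
  embed-inside M s (i , n , m) = embed-on M s i , n ∘ embed-injective , m ∘ embed-injective

  private
    cancel-between : ∀ {a b t} → Between (ι a) (ι b) (ι t) → Betweenᶻ a b t
    cancel-between (inj₁ (p , q)) = inj₁ (ι-cancel-≤ p , ι-cancel-≤ q)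
    cancel-between (inj₂ (p , q)) = inj₂ (ι-cancel-≤ p , ι-cancel-≤ q)

  cancel-on : ∀ M s → embed M on embedˢ s → M onᶻ s
  cancel-on M (P , Q) (d , bx , by) =
    ι-injective (trans (sym (embed-det P Q P M)) d) , cancel-between bx , cancel-between by

  private
    below⇒disjoint : ∀ {a b c d r} → Below a b c d → Between (ι a) (ι b) r → ¬ Between (ι c) (ι d) r
    below⇒disjoint {a} {b} {c} {d} {r} (ac , ad , bc , bd) i j = <-irrefl refl (separate i j)
      where
      separate : Between (ι a) (ι b) r → Between (ι c) (ι d) r → r < r
      separate (inj₁ (_ , r≤b)) (inj₁ (c≤r , _)) = ≤-<-trans r≤b (<-≤-trans (ι-mono bc) c≤r)
      separate (inj₁ (_ , r≤b)) (inj₂ (d≤r , _)) = ≤-<-trans r≤b (<-≤-trans (ι-mono bd) d≤r)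
      separate (inj₂ (_ , r≤a)) (inj₁ (c≤r , _)) = ≤-<-trans r≤a (<-≤-trans (ι-mono ac) c≤r)
      separate (inj₂ (_ , r≤a)) (inj₂ (d≤r , _)) = ≤-<-trans r≤a (<-≤-trans (ι-mono ad) d≤r)

  boxes-disjoint : ∀ s t {r} → BoxesDisjoint s t → r on embedˢ s → ¬ r on embedˢ t
  boxes-disjoint s t (inj₁ (inj₁ p)) (_ , i , _) (_ , j , _) = below⇒disjoint p i j
  boxes-disjoint s t (inj₁ (inj₂ p)) (_ , i , _) (_ , j , _) = below⇒disjoint p j i
  boxes-disjoint s t (inj₂ (inj₁ p)) (_ , _ , i) (_ , _ , j) = below⇒disjoint p i j
  boxes-disjoint s t (inj₂ (inj₂ p)) (_ , _ , i) (_ , _ , j) = below⇒disjoint p j i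

  private
    shift-det : ∀ {u P M r} → det u (r ⊖ P) ≡ 0# → det u (M ⊖ P) ≡ 0# → det u (r ⊖ M) ≡ 0#
    shift-det {u} {P} {M} {r} p q = trans
      (solve 8 (λ ux uy px py mx my rx ry →
         ux :* (ry :- my) :- uy :* (rx :- mx)
           := (ux :* (ry :- py) :- uy :* (rx :- px)) :- (ux :* (my :- py) :- uy :* (mx :- px)))
         refl (x u) (y u) (x P) (y P) (x M) (y M) (x r) (y r))
      (trans (cong₂ _-_ p q) (-‿inverseʳ 0#))

    -- Cramer's rule: `det u v` times `w` equals `det u w` times `v` minus `det v w` times `u`.
    det-cancel : ∀ {u v w} → det u v ≢ 0# → det u w ≡ 0# → det v w ≡ 0# → x w ≡ 0# × y w ≡ 0#
    det-cancel {u} {v} {w} n p q =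
      *-cancel-zero n (trans
        (solve 6 (λ a b c d e f → (a :* d :- b :* c) :* e
           := c :* (a :* f :- b :* e) :- a :* (c :* f :- d :* e))
           refl (x u) (y u) (x v) (y v) (x w) (y w)) (vanish (x v) (x u))) ,
      *-cancel-zero n (trans
        (solve 6 (λ a b c d e f → (a :* d :- b :* c) :* f
           := d :* (a :* f :- b :* e) :- b :* (c :* f :- d :* e))
           refl (x u) (y u) (x v) (y v) (x w) (y w)) (vanish (y v) (y u)))
      where
      vanish : ∀ a b → a * det u w - b * det v w ≡ 0#
      vanish a b = trans (cong₂ (λ i j → a * i - b * j) p q)
        (solve 2 (λ a b → a :* con 0ℤ :- b :* con 0ℤ := con 0ℤ) refl a b)

    ≡0⇒≡ : ∀ {a b} → a - b ≡ 0# → a ≡ b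
    ≡0⇒≡ {a} {b} e = trans (solve 2 (λ a b → a := (a :- b) :+ b) refl a b)
      (trans (cong (_+ b) e) (+-identityˡ b))

  -- The vector from `M` to `r` is parallel to both segments, whose directions are independent, so
  -- it vanishes.
  meet-only-at : ∀ M s t {r} → MeetOnlyAt M s t → r on embedˢ s → r on embedˢ t → r ≡ embed M
  meet-only-at M (P , Q) (P′ , Q′) {r} (Ms , Mt , n) (rs , _) (rt , _) =
    cong₂ ⟨_,_⟩ (≡0⇒≡ (proj₁ r-M≡0)) (≡0⇒≡ (proj₂ r-M≡0))
    where
    r-M≡0 : x (r ⊖ embed M) ≡ 0# × y (r ⊖ embed M) ≡ 0#
    r-M≡0 = det-cancel {embed Q ⊖ embed P} {embed Q′ ⊖ embed P′} {r ⊖ embed M}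
      (λ e → n (ι-injective (trans (sym (embed-det P Q P′ Q′)) e)))
      (shift-det {embed Q ⊖ embed P} {embed P} {embed M} rs (trans (embed-det P Q P M) (cong ι Ms)))
      (shift-det {embed Q′ ⊖ embed P′} {embed P′} {embed M} rt (trans (embed-det P′ Q′ P′ M) (cong ι Mt)))

  disjoint : ∀ s t {r} → Disjointᶻ s t → r on embedˢ s → ¬ r on embedˢ t
  disjoint s t (inj₁ d) rs rt = boxes-disjoint s t d rs rt
  disjoint s t {r} (inj₂ (m , off)) rs rt = off-segment (cramer s t) (meet-only-at (cramer s t) s t m rs rt) off
    where
    off-segment : ∀ M → r ≡ embed M → ¬ (¬ M onᶻ s ⊎ ¬ M onᶻ t)
    off-segment M refl (inj₁ n) = n (cancel-on M s rs)
    off-segment M refl (inj₂ n) = n (cancel-on M t rt)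

  on-sym : ∀ {r A B} → r on (A , B) → r on (B , A)
  on-sym {r} {A} {B} (d , bx , by) = trans (trans
      (solve 6 (λ a b c d e f → (a :- c) :* (f :- d) :- (b :- d) :* (e :- c)
         := :- ((c :- a) :* (f :- b) :- (d :- b) :* (e :- a))) refl (x A) (y A) (x B) (y B) (x r) (y r))
      (cong -_ d)) (solve 0 (:- con 0ℤ := con 0ℤ) refl) , swap bx , swap by
    where
    swap : ∀ {a b t} → Between a b t → Between b a t
    swap (inj₁ p) = inj₂ p
    swap (inj₂ p) = inj₁ p

  on-start : ∀ A B → A on (A , B)
  on-start A B =
    solve 4 (λ a b c d → (c :- a) :* (b :- b) :- (d :- b) :* (a :- a) := con 0ℤ) refl
      (x A) (y A) (x B) (y B) , near (x A) (x B) , near (y A) (y B)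
    where
    near : ∀ a b → Between a b a
    near a b with compare a b
    ... | tri< l _ _ = inj₁ (inj₂ refl , inj₁ l)
    ... | tri≈ _ e _ = inj₁ (inj₂ refl , inj₂ e)
    ... | tri> _ _ l = inj₂ (inj₁ l , inj₂ refl)

  meet-at-most-at : ∀ M s t {r} → MeetAtMostAt M s t → r on embedˢ s → r on embedˢ t → r ≡ embed M
  meet-at-most-at M s t (inj₁ d) rs rt = contradiction rt (disjoint s t d rs)
  meet-at-most-at M s t (inj₂ m) rs rt = meet-only-at M s t m rs rt

  private
    clear : ∀ {a c d r} → c ℤ.< a → d ℤ.< a → ι a ≤ r → ¬ Between (ι c) (ι d) r
    clear c<a d<a a≤r (inj₁ (_ , r≤d)) = ≤⇒≯ (≤-trans a≤r r≤d) (ι-mono d<a)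
    clear c<a d<a a≤r (inj₂ (_ , r≤c)) = ≤⇒≯ (≤-trans a≤r r≤c) (ι-mono c<a)

    clear′ : ∀ {b c d r} → b ℤ.< c → b ℤ.< d → r ≤ ι b → ¬ Between (ι c) (ι d) r
    clear′ b<c b<d r≤b (inj₁ (c≤r , _)) = ≤⇒≯ (≤-trans c≤r r≤b) (ι-mono b<c)
    clear′ b<c b<d r≤b (inj₂ (d≤r , _)) = ≤⇒≯ (≤-trans d≤r r≤b) (ι-mono b<d)

  missed-by-ray : ∀ P s {r} → MissedByRay P s → x (embed P) ≤ x r → y r ≡ y (embed P) → ¬ r on embedˢ s
  missed-by-ray P s (inj₁ (c , d))        P≤r e (_ , i , _) = clear c d P≤r i
  missed-by-ray P s (inj₂ (inj₁ (c , d))) P≤r e (_ , _ , i) = clear c d (inj₂ (sym e)) i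
  missed-by-ray P s (inj₂ (inj₂ (c , d))) P≤r e (_ , _ , i) = clear′ c d (inj₂ e) i

Ccwᶻ : Lattice → Lattice → Lattice → Set
Ccwᶻ u v w = (0ℤ ℤ.< detᶻ u v × 0ℤ ℤ.< detᶻ v w) ⊎
             (0ℤ ℤ.< detᶻ v w × 0ℤ ℤ.< detᶻ w u) ⊎
             (0ℤ ℤ.< detᶻ w u × 0ℤ ℤ.< detᶻ u v)

ccwᶻ? : ∀ u v w → Dec (Ccwᶻ u v w)
ccwᶻ? u v w = (0ℤ ℤ.<? detᶻ u v ×-dec 0ℤ ℤ.<? detᶻ v w) ⊎-dec
              (0ℤ ℤ.<? detᶻ v w ×-dec 0ℤ ℤ.<? detᶻ w u) ⊎-dec
              (0ℤ ℤ.<? detᶻ w u ×-dec 0ℤ ℤ.<? detᶻ u v)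

AllTriples : ∀ {a p} {A : Set a} → (A → A → A → Set p) → List A → Set (a ⊔ p)
AllTriples P []       = ⊤
AllTriples P (a ∷ as) = AllPairs (P a) as × AllTriples P as

allTriples? : ∀ {a p} {A : Set a} {P : A → A → A → Set p} →
  (∀ a b d → Dec (P a b d)) → ∀ as → Dec (AllTriples P as)
allTriples? P? []       = yes tt
allTriples? P? (a ∷ as) = AllPairs.allPairs? (P? a) as ×-dec allTriples? P? as

triple : ∀ {a p} {A : Set a} {P : A → A → A → Set p} {as b₁ b₂ b₃} →
  AllTriples P as → b₁ ∷ b₂ ∷ b₃ ∷ [] ⊆ as → P b₁ b₂ b₃
triple (_ , ts) (_ ∷ʳ i)   = triple ts i
triple (ps , _) (refl ∷ i) = pair ps i
  where
  pair : ∀ {a r} {A : Set a} {R : A → A → Set r} {as b₁ b₂} →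
    AllPairs R as → b₁ ∷ b₂ ∷ [] ⊆ as → R b₁ b₂
  pair (_ ∷ ps) (_ ∷ʳ i)   = pair ps i
  pair (p ∷ _)  (refl ∷ i) = All.lookup p (to∈ i)

-- Integer certificates for straight-line drawings

module StraightLine {G : Graph} (E : Embedding G)
  (at : Graph.Vertex G → Lattice) (X : Graph.Edge G → Lattice) where
  open Graph G
  open Embedding E

  seg : Edge → LatticeSegment
  seg e = at (src e) , at (tgt e)

  vector : Dart → Lattice
  vector d = at (tip d) ⊖ᶻ at (tail d)

  Meeting : Edge → Edge → Set
  Meeting e f = Disjointᶻ (seg e) (seg f) ⊎
    (∃[ w ] Incident w e × Incident w f × MeetOnlyAt (at w) (seg e) (seg f)) ⊎
    (crossing e ≡ just f × MeetOnlyAt (X e) (seg e) (seg f))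

  Crossed : Edge → Edge → Set
  Crossed e f = e ≢ f × X e insideᶻ seg e × X e insideᶻ seg f ×
    detᶻ (at (tgt e) ⊖ᶻ at (src e)) (at (tgt f) ⊖ᶻ at (src f)) ≢ 0ℤ ×
    (∀ v → ¬ (Incident v e × Incident v f))

  -- A finite certificate for `InOuterFace`: the single condition on the final ray covers all bounds
  -- at once.
  Escape : Lattice → List Lattice → Set
  Escape P []       = ∀ f → MissedByRay P (seg f)
  Escape P (Q ∷ Qs) = Aligned P Q × (∀ f → Disjointᶻ (P , Q) (seg f)) × Escape Q Qs

  OuterCornerᶻ : Dart → Lattice → Lattice → List Lattice → Set
  OuterCornerᶻ d M P Qs =
    M insideᶻ (at (tail d) , at (tip d)) ×
    (∀ f → f ≢ edge d → MeetAtMostAt (at (tail d)) (at (tail d) , M) (seg f)) ×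
    Aligned M P ×
    0ℤ ℤ.< detᶻ (vector d) (P ⊖ᶻ M) ×
    (∀ f → MeetAtMostAt M (M , P) (seg f)) ×
    Escape P Qs

  incident? : ∀ v e → Dec (Incident v e)
  incident? v e = v Fin.≟ src e ⊎-dec v Fin.≟ tgt e

  crossing? : ∀ e f → Dec (crossing e ≡ just f)
  crossing? e f = Maybe.≡-dec Fin._≟_ (crossing e) (just f)

  meeting? : ∀ e f → Dec (Meeting e f)
  meeting? e f = disjointᶻ? (seg e) (seg f) ⊎-dec
    (Fin.any? λ w → incident? w e ×-dec incident? w f ×-dec meetOnlyAt? (at w) (seg e) (seg f)) ⊎-dec
    (crossing? e f ×-dec meetOnlyAt? (X e) (seg e) (seg f))

  crossed? : ∀ e f → Dec (Crossed e f)
  crossed? e f = ¬? (e Fin.≟ f) ×-dec X e insideᶻ? seg e ×-dec X e insideᶻ? seg f ×-dec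
    ¬? (detᶻ (at (tgt e) ⊖ᶻ at (src e)) (at (tgt f) ⊖ᶻ at (src f)) ℤ.≟ 0ℤ) ×-dec
    Fin.all? λ v → ¬? (incident? v e ×-dec incident? v f)

  escape? : ∀ P Qs → Dec (Escape P Qs)
  escape? P []       = Fin.all? λ f → missedByRay? P (seg f)
  escape? P (Q ∷ Qs) =
    aligned? P Q ×-dec (Fin.all? λ f → disjointᶻ? (P , Q) (seg f)) ×-dec escape? Q Qs

  outerCornerᶻ? : ∀ d M P Qs → Dec (OuterCornerᶻ d M P Qs)
  outerCornerᶻ? d M P Qs =
    (M insideᶻ? (at (tail d) , at (tip d))) ×-dec
    (Fin.all? λ f → ¬? (f Fin.≟ edge d) →-dec
      meetAtMostAt? (at (tail d)) (at (tail d) , M) (seg f)) ×-dec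
    aligned? M P ×-dec
    0ℤ ℤ.<? detᶻ (vector d) (P ⊖ᶻ M) ×-dec
    (Fin.all? λ f → meetAtMostAt? M (M , P) (seg f)) ×-dec
    escape? P Qs

  record Valid : Set where
    field
      distinct : ∀ u v → at u ≡ at v → u ≡ v
      avoiding : ∀ e v → at v onᶻ seg e → Incident v e
      meetings : ∀ e f → e ≢ f → Meeting e f
      crossed  : ∀ e f → crossing e ≡ just f → Crossed e f
      ccw      : ∀ v → AllTriples (λ d d′ d″ → Ccwᶻ (vector d) (vector d′) (vector d″)) (rotation v)
      corners  : ∀ v → ∃[ M ] ∃[ P ] ∃[ Qs ] OuterCornerᶻ (outer v) M P Qs

  module Realization (valid : Valid) {c ℓ : Level} (K : OrderedField c ℓ) where
    open Valid valid
    open Points K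
    open LatticePoints K

    private
      edge-end : ∀ {A B r} → r onPath (A ∷ B ∷ []) → r on (A , B)
      edge-end (here r) = r

      classify : ∀ {e f r} → e ≢ f → r on embedˢ (seg e) → r on embedˢ (seg f) →
        (∃[ w ] Incident w e × Incident w f × r ≡ embed (at w)) ⊎ (crossing e ≡ just f × r ≡ embed (X e))
      classify {e} {f} e≢f re rf with meetings e f e≢f
      ... | inj₁ d                       = contradiction rf (disjoint (seg e) (seg f) d re)
      ... | inj₂ (inj₁ (w , we , wf , m)) = inj₁ (w , we , wf , meet-only-at (at w) (seg e) (seg f) m re rf)
      ... | inj₂ (inj₂ (cr , m))          = inj₂ (cr , meet-only-at (X e) (seg e) (seg f) m re rf)

      loop-free : ∀ e → embed (at (src e)) ≢ embed (at (tgt e))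
      loop-free e p = no-loop e (distinct _ _ (embed-injective p))

    drawing : Drawing K G
    drawing = record
      { pos = embed ∘ at
      ; bends = λ _ → []
      ; pos-injective = distinct _ _ ∘ embed-injective
      ; path-simple = λ e → loop-free e , (λ _ _ ()) , tt
      ; avoids = λ e v i → avoiding e v (cancel-on (at v) (seg e) (edge-end i))
      ; adjacent = λ {e} {f} {v} ve vf (e≢f , re , rf , ¬v) →
          adjacent-disjoint ve vf ¬v (classify e≢f (edge-end re) (edge-end rf))
      ; transversal = λ {e} {f} (e≢f , re , rf , ¬v) →
          embedˢ (seg e) , embedˢ (seg f) , here refl , here refl ,
          transversally ¬v (classify e≢f (edge-end re) (edge-end rf))
      }
      where
      adjacent-disjoint : ∀ {e f v r} → Incident v e → Incident v f → (∀ v → r ≢ embed (at v)) →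
        ¬ ((∃[ w ] Incident w e × Incident w f × r ≡ embed (at w)) ⊎ (crossing e ≡ just f × r ≡ embed (X e)))
      adjacent-disjoint ve vf ¬v (inj₁ (w , _ , _ , e)) = ¬v w e
      adjacent-disjoint {e} {f} {v} ve vf ¬v (inj₂ (cr , _)) =
        proj₂ (proj₂ (proj₂ (proj₂ (crossed e f cr)))) v (ve , vf)
      transversally : ∀ {e f r} → (∀ v → r ≢ embed (at v)) →
        (∃[ w ] Incident w e × Incident w f × r ≡ embed (at w)) ⊎ (crossing e ≡ just f × r ≡ embed (X e)) →
        CrossTransversally (embedˢ (seg e)) (embedˢ (seg f)) r
      transversally ¬v (inj₁ (w , _ , _ , e)) = contradiction e (¬v w)
      transversally {e} {f} ¬v (inj₂ (cr , refl)) with crossed e f cr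
      ... | _ , Xe , Xf , det≢0 , _ = embed-inside (X e) (seg e) Xe , embed-inside (X e) (seg f) Xf ,
        λ z → det≢0 (ι-injective (trans (sym (embed-det (at (src e)) (at (tgt e)) (at (src f)) (at (tgt f)))) z))

    open Drawing drawing

    private
      crossing-point : ∀ {e f r} → CrossAt e f r → crossing e ≡ just f × r ≡ embed (X e)
      crossing-point (e≢f , re , rf , ¬v) with classify e≢f (edge-end re) (edge-end rf)
      ... | inj₁ (w , _ , _ , r≡) = contradiction r≡ (¬v w)
      ... | inj₂ cr               = cr

      crosses-at : ∀ {e f} → crossing e ≡ just f → CrossAt e f (embed (X e))
      crosses-at {e} {f} cr with crossed e f cr
      ... | e≢f , (Xe , _) , (Xf , _) , _ , apart =
        e≢f , here (embed-on (X e) (seg e) Xe) , here (embed-on (X e) (seg f) Xf) ,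
        λ v X≡v → apart v (on-vertex (embed-injective X≡v) Xe , on-vertex (embed-injective X≡v) Xf)
        where
        on-vertex : ∀ {M g v} → M ≡ at v → M onᶻ seg g → Incident v g
        on-vertex {g = g} {v} refl i = avoiding g v i

      onePlanar : OnePlanar K G drawing
      onePlanar e f g r s ef eg with crossing-point ef | crossing-point eg
      ... | cf , refl | cg , refl = Maybe.just-injective (trans (sym cf) cg) , refl

      direction≡ : ∀ d → direction d ≡ embed (at (tip d)) ⊖ embed (at (tail d))
      direction≡ (fwd e) = refl
      direction≡ (bwd e) = refl

      next≡ : ∀ d → next d ≡ embed (at (tip d))
      next≡ (fwd e) = refl
      next≡ (bwd e) = refl

      0<det : ∀ d d′ → 0ℤ ℤ.< detᶻ (vector d) (vector d′) → 0# < det (direction d) (direction d′)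
      0<det d d′ p = subst₂ (λ u v → 0# < det u v) (sym (direction≡ d)) (sym (direction≡ d′))
        (<-respʳ (ι-pos p) (sym (embed-det (at (tail d)) (at (tip d)) (at (tail d′)) (at (tip d′)))))

      counterclockwise : ∀ {d d′ d″} → Ccwᶻ (vector d) (vector d′) (vector d″) →
        Counterclockwise (direction d) (direction d′) (direction d″)
      counterclockwise {d} {d′} {d″} (inj₁ (p , q))        = inj₁ (0<det d d′ p , 0<det d′ d″ q)
      counterclockwise {d} {d′} {d″} (inj₂ (inj₁ (p , q))) = inj₂ (inj₁ (0<det d′ d″ p , 0<det d″ d q))
      counterclockwise {d} {d′} {d″} (inj₂ (inj₂ (p , q))) = inj₂ (inj₂ (0<det d″ d p , 0<det d d′ q))

      tail-on : ∀ d → embed (at (tail d)) on embedˢ (seg (edge d))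
      tail-on (fwd e) = on-start _ _
      tail-on (bwd e) = on-sym (on-start _ _)

      free : ∀ {r} → (∀ f → ¬ r on embedˢ (seg f)) → Free r
      -- Every vertex is the tail of its outer dart and so lies on an edge; a point off all edges is
      -- therefore no vertex.
      free {r} off = (λ v r≡v → off (edge (outer v)) (subst (_on embedˢ (seg (edge (outer v))))
          (sym (trans r≡v (cong (embed ∘ at) (sym (outer-tail v))))) (tail-on (outer v)))) ,
        λ e → off e ∘ edge-end

      aligned : ∀ P Q → Aligned P Q → AxisParallel (embed P , embed Q)
      aligned P Q (inj₁ h) = inj₁ (cong ι h)
      aligned P Q (inj₂ v) = inj₂ (cong ι v)

      ray : ∀ P → (∀ f → MissedByRay P (seg f)) → InOuterFace (embed P)
      ray P missed b with b <? x (embed P)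
      ... | yes b<P = embed P , stay , b<P
      ... | no b≮P  = ⟨ b + 1# , y (embed P) ⟩ , (inj₁ refl , on-ray) ◅ stay , b<b+1
        where
        b<b+1 : b < b + 1#
        b<b+1 = subst (_< b + 1#) (+-identityʳ b) (+-monoʳ-< b 0<1)
        P<b+1 : x (embed P) < b + 1#
        P<b+1 with compare b (x (embed P))
        ... | tri< b<P _ _  = contradiction b<P b≮P
        ... | tri≈ _ refl _ = b<b+1
        ... | tri> _ _ P<b  = <-trans P<b b<b+1
        on-ray : ∀ r → r on (embed P , ⟨ b + 1# , y (embed P) ⟩) → Free r
        on-ray r (_ , i , j) = free λ f → missed-by-ray P (seg f) (missed f) (to-right i) (level j)
          where
          to-right : Between (x (embed P)) (b + 1#) (x r) → x (embed P) ≤ x r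
          to-right (inj₁ (p , _)) = p
          to-right (inj₂ (p , q)) = contradiction P<b+1 (≤⇒≯ (≤-trans p q))
          level : Between (y (embed P)) (y (embed P)) (y r) → y r ≡ y (embed P)
          level (inj₁ (p , q)) = ≤-antisym q p
          level (inj₂ (p , q)) = ≤-antisym q p

      escape : ∀ P Qs → Escape P Qs → InOuterFace (embed P)
      escape P []       missed            = ray P missed
      escape P (Q ∷ Qs) (al , off , rest) b with escape Q Qs rest b
      ... | q , path , b<q =
        q , (aligned P Q al , λ r rPQ → free λ f → disjoint (P , Q) (seg f) (off f) rPQ) ◅ path , b<q

      outer-corner : ∀ d M P Qs → OuterCornerᶻ d M P Qs → OuterCorner d
      outer-corner d M P Qs (ins , near , al , turn , leave , esc) =
        embed M , embed P ,
        subst (λ q → embed M inside (embed (at (tail d)) , q)) (sym (next≡ d))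
          (embed-inside M (at (tail d) , at (tip d)) ins) ,
        (λ f r f≢d i j →
          meet-at-most-at (at (tail d)) (at (tail d) , M) (seg f) (near f f≢d) i (edge-end j)) ,
        aligned M P al ,
        subst (λ u → 0# < det u (embed P ⊖ embed M)) (sym (direction≡ d))
          (<-respʳ (ι-pos turn) (sym (embed-det (at (tail d)) (at (tip d)) M P))) ,
        (λ r i → leaving r i (r ≟ᴾ embed M)) ,
        escape P Qs esc
        where
        leaving : ∀ r → r on (embed M , embed P) → Dec (r ≡ embed M) → r ≡ embed M ⊎ Free r
        leaving r i (yes e) = inj₁ e
        leaving r i (no n)  = inj₂ (free λ f j → n (meet-at-most-at M (M , P) (seg f) (leave f) i j))

      outer-corners : ∀ v → OuterCorner (outer v)
      outer-corners v with corners v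
      ... | M , P , Qs , o = outer-corner (outer v) M P Qs o

    isOuterOnePlane : IsOuterOnePlane K G E
    isOuterOnePlane = drawing ,
      (onePlanar , λ v → outer v , outer-tail v , outer-corners v) ,
      record
        { rotations = λ v {d} {d′} {d″} i → counterclockwise {d} {d′} {d″} (triple (ccw v) i)
        ; crossings = λ e f →
            mk⇔ (λ cr → embed (X e) , crosses-at cr) (λ (r , ef) → proj₁ (crossing-point ef))
        ; outerFace = outer-corners
        }

-- The graph

pattern ab   = 0F
pattern bc   = 1F
pattern cd   = 2F
pattern da   = 3F
pattern ac   = 4F
pattern bd   = 5F
pattern a′b′ = 6F
pattern b′c′ = 7F
pattern c′d′ = 8F
pattern d′a′ = 9F
pattern a′c′ = suc 9F
pattern b′d′ = suc a′c′
pattern aa′  = suc b′d′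
pattern bb′  = suc aa′

-- a, b, c, d are the vertices 0, 1, 2, 3 and a′, b′, c′, d′ the vertices 4, 5, 6, 7.
ends : Vec (Fin 8 × Fin 8) 14
ends = (0F , 1F) ∷ (1F , 2F) ∷ (2F , 3F) ∷ (3F , 0F) ∷ (0F , 2F) ∷ (1F , 3F) ∷
       (4F , 5F) ∷ (5F , 6F) ∷ (6F , 7F) ∷ (7F , 4F) ∷ (4F , 6F) ∷ (5F , 7F) ∷
       (0F , 4F) ∷ (1F , 5F) ∷ []

private
  source target : Fin 14 → Fin 8
  source e = proj₁ (lookup ends e)
  target e = proj₂ (lookup ends e)

abstract
  loopless : ∀ e → source e ≢ target e
  loopless = from-yes (Fin.all? λ e → ¬? (source e Fin.≟ target e))

  no-parallel : ∀ e f →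
    (source e ≡ source f × target e ≡ target f) ⊎ (source e ≡ target f × target e ≡ source f) → e ≡ f
  no-parallel = from-yes (Fin.all? λ e → Fin.all? λ f →
    ((source e Fin.≟ source f ×-dec target e Fin.≟ target f) ⊎-dec
     (source e Fin.≟ target f ×-dec target e Fin.≟ source f)) →-dec (e Fin.≟ f))

twoK₄ : Graph
twoK₄ = record
  { n = 8 ; m = 14 ; src = source ; tgt = target ; no-loop = loopless ; simple = no-parallel }

open Graph twoK₄

_≟ᵈ_ : DecidableEquality Dart
fwd e ≟ᵈ fwd f = map′ (cong fwd) (λ { refl → refl }) (e Fin.≟ f)
fwd e ≟ᵈ bwd f = no λ ()
bwd e ≟ᵈ fwd f = no λ ()
bwd e ≟ᵈ bwd f = map′ (cong bwd) (λ { refl → refl }) (e Fin.≟ f)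

open DecMembership _≟ᵈ_ using (_∈?_)

all-darts? : ∀ {p} {P : Dart → Set p} → (∀ d → Dec (P d)) → Dec (∀ d → P d)
all-darts? P? = map′ (λ (f , b) → λ { (fwd e) → f e ; (bwd e) → b e })
                     (λ P → (P ∘ fwd) , (P ∘ bwd))
                     (Fin.all? (P? ∘ fwd) ×-dec Fin.all? (P? ∘ bwd))

private
  -- Each list is cut at the outer corner of its vertex, so the pairs of neighbours in it are
  -- exactly the angles inside kites.
  rot : Vertex → List Dart
  rot = lookup (
    (fwd aa′ ∷ fwd ab ∷ fwd ac ∷ bwd da ∷ []) ∷
    (fwd bc ∷ fwd bd ∷ bwd ab ∷ fwd bb′ ∷ []) ∷
    (fwd cd ∷ bwd ac ∷ bwd bc ∷ []) ∷
    (fwd da ∷ bwd bd ∷ bwd cd ∷ []) ∷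
    (bwd aa′ ∷ fwd a′b′ ∷ fwd a′c′ ∷ bwd d′a′ ∷ []) ∷
    (fwd b′c′ ∷ fwd b′d′ ∷ bwd a′b′ ∷ bwd bb′ ∷ []) ∷
    (fwd c′d′ ∷ bwd a′c′ ∷ bwd b′c′ ∷ []) ∷
    (fwd d′a′ ∷ bwd b′d′ ∷ bwd c′d′ ∷ []) ∷ [])

  outward : Vertex → Dart
  outward = lookup
    (bwd da ∷ fwd bb′ ∷ bwd bc ∷ bwd cd ∷ bwd d′a′ ∷ bwd bb′ ∷ bwd b′c′ ∷ bwd c′d′ ∷ [])

  crossed : Edge → Maybe Edge
  crossed = lookup
    (nothing ∷ nothing ∷ nothing ∷ nothing ∷ just bd ∷ just ac ∷
     nothing ∷ nothing ∷ nothing ∷ nothing ∷ just b′d′ ∷ just a′c′ ∷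
     just bb′ ∷ just aa′ ∷ [])

abstract
  rot-unique : ∀ v → Unique (rot v)
  rot-unique = from-yes (Fin.all? λ v → AllPairs.allPairs? (λ d d′ → ¬? (d ≟ᵈ d′)) (rot v))

  rot-complete : ∀ v d → (d ∈ rot v → tail d ≡ v) × (tail d ≡ v → d ∈ rot v)
  rot-complete = from-yes (Fin.all? λ v → all-darts? λ d →
    (d ∈? rot v →-dec tail d Fin.≟ v) ×-dec (tail d Fin.≟ v →-dec d ∈? rot v))

  outward-tail : ∀ v → tail (outward v) ≡ v
  outward-tail = from-yes (Fin.all? λ v → tail (outward v) Fin.≟ v)

embedding : Embedding twoK₄
embedding = record
  { rotation = rot
  ; rotation-unique = rot-unique
  ; rotation-darts = λ v d → mk⇔ (proj₁ (rot-complete v d)) (proj₂ (rot-complete v d))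
  ; crossing = crossed
  ; outer = outward
  ; outer-tail = outward-tail
  }

-- Biconnectivity and degrees

private
  Reach : Vertex → ℕ → Vertex → Vertex → Set
  Reach w zero    u v = u ≡ v
  Reach w (suc k) u v = u ≡ v ⊎ ∃[ e ]
    ((source e ≡ u × target e ≢ w × Reach w k (target e) v) ⊎
     (target e ≡ u × source e ≢ w × Reach w k (source e) v))

  reach? : ∀ w k u v → Dec (Reach w k u v)
  reach? w zero    u v = u Fin.≟ v
  reach? w (suc k) u v = u Fin.≟ v ⊎-dec Fin.any? λ e →
    (source e Fin.≟ u ×-dec ¬? (target e Fin.≟ w) ×-dec reach? w k (target e) v) ⊎-dec
    (target e Fin.≟ u ×-dec ¬? (source e Fin.≟ w) ×-dec reach? w k (source e) v)

  reach : ∀ {w} k {u v} → u ≢ w → Reach w k u v → Star (λ s t → s ≢ w × t ≢ w × Adjacent s t) u v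
  reach zero    _   refl        = stay
  reach (suc k) _   (inj₁ refl) = stay
  reach (suc k) u≢w (inj₂ (e , inj₁ (refl , t≢w , r))) =
    (u≢w , t≢w , fwd e , refl , refl) ◅ reach k t≢w r
  reach (suc k) u≢w (inj₂ (e , inj₂ (refl , t≢w , r))) =
    (u≢w , t≢w , bwd e , refl , refl) ◅ reach k t≢w r

abstract
  connectedWithout : ∀ w → ConnectedWithout w
  -- Length 3 is what distant pairs such as c and c′ require; these two are joined by disjoint paths
  -- of that length through `aa′` and through `bb′`.
  connectedWithout w u v u≢w v≢w = reach 3 u≢w (from-yes (Fin.all? λ w → Fin.all? λ u → Fin.all? λ v →
    ¬? (u Fin.≟ w) →-dec ¬? (v Fin.≟ w) →-dec reach? w 3 u v) w u v u≢w v≢w)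

  third-vertex : ∀ (u v : Vertex) → ∃[ w ] u ≢ w × v ≢ w
  third-vertex = from-yes (Fin.all? {n = 8} λ u → Fin.all? {n = 8} λ v → Fin.any? {n = 8} λ w →
    ¬? (u Fin.≟ w) ×-dec ¬? (v Fin.≟ w))

  biconnected : Biconnected
  biconnected = s≤s (s≤s (s≤s z≤n)) , connected , connectedWithout
    where
    connected : Connected
    connected u v with third-vertex u v
    ... | w , u≢w , v≢w = Star.map (proj₂ ∘ proj₂) (connectedWithout w u v u≢w v≢w)

  maxDegree≤4 : MaxDegree≤ 4
  maxDegree≤4 = from-yes (Fin.all? λ v → degree v ℕ.≤? 4)

-- A straight-line drawing

private
  -- A square and its image under the half-turn about (8, 2), the crossing of `aa′` and `bb′`. A
  -- half-turn preserves orientation, so both copies get the same rotations. Side length 4 makes the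
  -- centres of the squares lattice points.
  place : Vertex → Lattice
  place = lookup (
    (nat 4 , nat 0) ∷ (nat 4 , nat 4) ∷ (nat 0 , nat 4) ∷ (nat 0 , nat 0) ∷
    (nat 12 , nat 4) ∷ (nat 12 , nat 0) ∷ (nat 16 , nat 0) ∷ (nat 16 , nat 4) ∷ [])

  crossing-place : Edge → Lattice
  crossing-place ac   = nat 2 , nat 2
  crossing-place bd   = nat 2 , nat 2
  crossing-place a′c′ = nat 14 , nat 2
  crossing-place b′d′ = nat 14 , nat 2
  -- The crossing of `aa′` and `bb′`; a dummy value for the uncrossed edges.
  crossing-place _    = nat 8 , nat 2

  -- Witnesses for the outer corners: a point of the edge, its neighbour in the outer face, and way
  -- points from which the ray to the right is free.
  escapes : Vertex → Lattice × Lattice × List Lattice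
  escapes = lookup (
    ((nat 2 , nat 0) , (nat 2 , -1ℤ) , []) ∷
    ((nat 6 , nat 3) , (nat 6 , nat 5) , []) ∷
    ((nat 2 , nat 4) , (nat 2 , nat 5) , []) ∷
    ((nat 0 , nat 2) , (-1ℤ , nat 2) , (-1ℤ , nat 5) ∷ []) ∷
    ((nat 14 , nat 4) , (nat 14 , nat 5) , []) ∷
    ((nat 10 , nat 1) , (nat 10 , -1ℤ) , []) ∷
    ((nat 14 , nat 0) , (nat 14 , -1ℤ) , []) ∷
    ((nat 16 , nat 2) , (nat 17 , nat 2) , []) ∷ [])

open StraightLine embedding place crossing-place

abstract
  distinct : ∀ u v → place u ≡ place v → u ≡ v
  distinct = from-yes (Fin.all? λ u → Fin.all? λ v → (place u ≟ᶻ place v) →-dec (u Fin.≟ v))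

  avoiding : ∀ e v → place v onᶻ seg e → Incident v e
  avoiding = from-yes (Fin.all? λ e → Fin.all? λ v → (place v onᶻ? seg e) →-dec incident? v e)

  meetings : ∀ e f → e ≢ f → Meeting e f
  meetings = from-yes (Fin.all? λ e → Fin.all? λ f → ¬? (e Fin.≟ f) →-dec meeting? e f)

  crossings-valid : ∀ e f → Embedding.crossing embedding e ≡ just f → Crossed e f
  crossings-valid = from-yes (Fin.all? λ e → Fin.all? λ f → crossing? e f →-dec crossed? e f)

  rotations-ccw : ∀ v →
    AllTriples (λ d d′ d″ → Ccwᶻ (vector d) (vector d′) (vector d″)) (Embedding.rotation embedding v)
  rotations-ccw = from-yes (Fin.all? λ v →
    allTriples? (λ d d′ d″ → ccwᶻ? (vector d) (vector d′) (vector d″)) (Embedding.rotation embedding v))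

  escapes-valid : ∀ v → let (M , P , Qs) = escapes v in
    OuterCornerᶻ (Embedding.outer embedding v) M P Qs
  escapes-valid = from-yes (Fin.all? λ v → let (M , P , Qs) = escapes v in
    outerCornerᶻ? (Embedding.outer embedding v) M P Qs)

valid : Valid
valid = record
  { distinct = distinct
  ; avoiding = avoiding
  ; meetings = meetings
  ; crossed  = crossings-valid
  ; ccw      = rotations-ccw
  ; corners  = λ v → _ , _ , _ , escapes-valid v
  }

-- The two forced bends

no-OC₂-layout : ∀ {c ℓ : Level} (K : OrderedField c ℓ) → ¬ OCLayout K twoK₄ 2 embedding
no-OC₂-layout K (D , (onePlanar , _) , realizes , orthogonal , oneBend) =
  -- `bb′` comes first because `one-bend` speaks of the first edge of a crossing.
  impossible (cross {ac} {bd} refl) (cross {a′c′} {b′d′} refl) (cross {bb′} {aa′} refl)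
  where
  open OrthogonalLayout D onePlanar realizes orthogonal oneBend
  bent-twice : ∀ {t t′} → t ≡ left → t′ ≡ left → ¬ (t ≡ ahead ⊎ t′ ≡ ahead)
  bent-twice refl _    (inj₁ ())
  bent-twice _    refl (inj₂ ())
  impossible : ∃[ X ] Cross X ac bd → ∃[ X′ ] Cross X′ a′c′ b′d′ → ¬ (∃[ Y ] Cross Y bb′ aa′)
  impossible (_ , X⊗) (_ , X′⊗) (_ , Y⊗) = bent-twice
    (half-edge-bent {ab = ab} {bc} {cd} {da} X⊗ refl refl refl refl refl refl refl refl
      crossAt (inj₁ refl) (inj₁ refl) e⁻ f⁻ e⁻f⁻
      (rotation⁴ 0F refl) (rotation⁴ 1F refl) (rotation³ 2F refl) (rotation³ 3F refl))
    -- By the half-turn symmetry of the embedding the argument applies to the far halves of `bb′`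
    -- and `aa′`, with the same orientation.
    (half-edge-bent {ab = a′b′} {b′c′} {c′d′} {d′a′} X′⊗ refl refl refl refl refl refl refl refl
      crossAt (inj₂ refl) (inj₂ refl) e⁺ f⁺ e⁺f⁺
      (rotation⁴ 4F refl) (rotation⁴ 5F refl) (rotation³ 6F refl) (rotation³ 7F refl))
    one-bend
    where open Cross Y⊗

theorem3 : ∀ {c ℓ : Level} (K : OrderedField c ℓ) →
    Σ Graph λ G → Σ (Embedding G) λ E →
    Graph.Biconnected G ×
    Graph.MaxDegree≤ G 4 ×
    IsOuterOnePlane K G E ×
    ¬ OCLayout K G 2 E
theorem3 K = twoK₄ , embedding , biconnected , maxDegree≤4 ,
  Realization.isOuterOnePlane valid K , no-OC₂-layout K
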